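{- Let $m,n$ be integers with $4\le m\le n-3$ (so that $S=\{2,m,n-1\}$ is $n$-admissible), and define $p(\{2,m,n-1\};n)$ by $\#P(\{2,m,n-1\};n)=p(\{2,m,n-1\};n)\,2^{n-4}$. Then $$2p(\{2,m,n-1\};n)=(m-3)(n-m-2)\binom{n-1}{m-1}+(n-1)\Big[(m-3)\binom{n-4}{m-1}+(m-2)\binom{n-4}{m-2}+(n-m-1)\binom{n-4}{m-3}+(n-m-2)\binom{n-4}{m-4}-2\binom{n-4}{1}\Big].$$ Moreover, for fixed $n$, the sequence $p(\{2,m,n-1\};n)$ for $4\le m\le n-3$ is symmetric and unimodal, and attains its maximum only at $m=\lfloor (n+1)/2\rfloor$ and at $m=\lceil (n+1)/2\rceil$.
   Context: For a permutation $\pi=a_1\ldots a_n$ of $\{1,\ldots,n\}$, an index $i$ is a peak if $a_{i-1}<a_i>a_{i+1}$. $P(S;n)$ is the set of permutations of $\{1,\dots,n\}$ whose set of peaks is exactly $S$. -}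

module Defs where

open import Data.Nat using (ℕ; zero; suc; _+_; _*_; _∸_; _^_; _≤_; _<_; _<ᵇ_; _≟_)
open import Data.Nat.Combinatorics using (_C_)
open import Data.Bool using (if_then_else_; _∧_)
open import Data.List using (List; []; _∷_; map; concatMap; upTo; filter; length)
open import Data.List.Properties using (≡-dec)
open import Data.List.Relation.Unary.Unique.DecPropositional _≟_ using (unique?)
open import Relation.Binary.PropositionalEquality using (_≡_)
open import Relation.Nullary.Decidable using (_×-dec_)
open import Data.Integer using (ℤ; +_; _-_) renaming (_+_ to _+ℤ_; _*_ to _*ℤ_)

words : ℕ → ℕ → List (List ℕ)
words zero    n = [] ∷ []
words (suc k) n = concatMap (λ w → map (λ a → a ∷ w) (map suc (upTo n))) (words k n)

-- Increasing list of the peaks of a word, positions 1-based: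
-- i is a peak iff a_{i-1} < a_i > a_{i+1}.  The argument i is the
-- position of the second letter of the given suffix.
peaksFrom : ℕ → List ℕ → List ℕ
peaksFrom i (a ∷ b ∷ c ∷ r) =
  if (a <ᵇ b) ∧ (c <ᵇ b) then i ∷ peaksFrom (suc i) (b ∷ c ∷ r)
                         else peaksFrom (suc i) (b ∷ c ∷ r)
peaksFrom i _ = []

peaks : List ℕ -> List ℕ
peaks w = peaksFrom 2 w

-- #P(S;n): number of permutations of {1,…,n} (words of length n over
-- {1,…,n} with pairwise distinct letters) whose peak set is exactly S,
-- where S is given as a strictly increasing list.
#P : List ℕ → ℕ → ℕ
#P S n = length (filter (λ w → unique? w ×-dec ≡-dec _≟_ (peaks w) S) (words n n))

S[2,_,_-1] : ℕ → ℕ → List ℕ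
S[2, m , n -1] = 2 ∷ m ∷ (n ∸ 1) ∷ []

-- Right-hand side of the formula for 2 p({2,m,n-1};n) (valid for 4 ≤ m ≤ n-3,
-- where all the natural-number subtractions below are exact).
rhs : ℕ → ℕ → ℤ
rhs m n =
  + ((m ∸ 3) * (n ∸ m ∸ 2) * ((n ∸ 1) C (m ∸ 1)))
  +ℤ (+ (n ∸ 1)) *ℤ
     ( + ( (m ∸ 3) * ((n ∸ 4) C (m ∸ 1))
         + (m ∸ 2) * ((n ∸ 4) C (m ∸ 2))
         + (n ∸ m ∸ 1) * ((n ∸ 4) C (m ∸ 3))
         + (n ∸ m ∸ 2) * ((n ∸ 4) C (m ∸ 4)))
       - + (2 * ((n ∸ 4) C 1)))

{-# OPTIONS --safe #-}
module Submission where

open import Defs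
open import Data.Nat using (ℕ; zero; suc; _∸_; _^_; _≤_; _<_; z≤n; s≤s; ⌊_/2⌋; ⌈_/2⌉)
open import Data.Product using (_×_; ∃)
open import Data.Sum using (_⊎_)
open import Relation.Binary.PropositionalEquality using (_≡_; _≢_)

open import Data.Bool using (Bool; true; false; _∧_; T)
open import Data.Bool.Properties using (∧-zeroʳ)
open import Data.Empty using (⊥-elim)
open import Data.List using (List; []; _∷_; _++_; map; concatMap; upTo; filter; length; replicate)
open import Data.List.Membership.DecPropositional Data.Nat._≟_ using (_∈?_)
open import Data.List.Membership.Propositional using (_∈_; _∉_; lose; find)
open import Data.List.Membership.Propositional.Properties using (∈-map⁺; ∈-map⁻; ∈-concatMap⁺; ∈-concatMap⁻; ∈-upTo⁺; ∈-upTo⁻; ∈-∃++; ∈-filter⁺; ∈-filter⁻)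
open import Data.List.Membership.Propositional.Properties.WithK using (unique∧set⇒bag)
open import Data.List.Properties using (∷-injectiveˡ; ∷-injectiveʳ; filter-all; filter-reject; filter-accept; ≡-dec; map-∘; map-++)
open import Data.List.Relation.Binary.BagAndSetEquality using (∼bag⇒↭)
open import Data.List.Relation.Binary.Permutation.Propositional using (_↭_; ↭-refl; ↭-sym; ↭-trans; ↭-prep; ↭-swap; ↭⇒↭ₛ)
open import Data.List.Relation.Binary.Permutation.Propositional.Properties using (All-resp-↭; ↭-length; shift; filter-↭)
import Data.List.Relation.Binary.Permutation.Setoid.Properties as Permutationₛ
open import Data.List.Relation.Unary.All as All using (All; []; _∷_)
open import Data.List.Relation.Unary.All.Properties using (¬Any⇒All¬; All¬⇒¬Any)
open import Data.List.Relation.Unary.AllPairs using ([]; _∷_)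
open import Data.List.Relation.Unary.Any using (here; there)
open import Data.List.Relation.Unary.Unique.DecPropositional Data.Nat._≟_ using (unique?)
open import Data.List.Relation.Unary.Unique.Propositional using (Unique)
import Data.List.Relation.Unary.Unique.Propositional.Properties as Unique
open import Data.Nat.Combinatorics using (_C_; nCn≡1; nC1≡n; nCk+nC[k+1]≡[n+1]C[k+1])
open import Data.Nat.ListAction using (sum)
open import Data.Nat.ListAction.Properties using (sum-++)
import Data.Nat.Properties as ℕₚ
open import Data.Nat.Solver renaming (module +-*-Solver to ℕ-Solver)
open import Data.Integer.Solver renaming (module +-*-Solver to ℤ-Solver)
open import Data.Product using (_,_; proj₁; proj₂; ∃₂)
open import Data.Sum using (inj₁; inj₂)
open import Function using (_∘_)
open import Function.Bundles using (mk⇔)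
open import Relation.Binary.PropositionalEquality using (refl; sym; trans; cong; cong₂; subst; subst₂; ≢-sym; setoid; module ≡-Reasoning)
open import Relation.Nullary using (¬_; yes; no)
open import Relation.Nullary.Decidable using (¬?; _×-dec_)
open import Relation.Unary using (Decidable)
open ≡-Reasoning

-- Record a permutation by its status word, the sequence of peak indicators of
-- its letters.  Inserting a new maximum strictly inside a permutation replaces
-- two adjacent indicators x y by F T F, and at either end it adds an F; so the
-- number of permutations with a given status word satisfies a linear
-- recurrence in the length of the word, with no reference to the letters.  For
-- at most three peaks, with the outer ones at 2 and n-1, this is Pascal's
-- recurrence with a source term, and for {2,m,n-1} its solution is
--   p = (m-3)(n-m-2) C(n-1,m-1) + 2(n-1) C(n-3,m-2) - 2 C(n-1,m-1) - (n-1)(n-4).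
-- Absorption identities turn this into the stated formula.  Symmetry and
-- unimodality are visible on it, since all m-dependent factors are symmetric
-- and increase towards the centre.

-- The obstacle is one of direction: inserting a maximum sends one status word to many, while a
-- count needs all words leading to a given one. `preimages` is therefore the transpose of
-- `insertions`, a functional that is linear in a function on words, so that the sum over
-- permutations passes through it. Words are then described by the lengths of their runs of
-- non-peaks. A run is bounded on each side by a peak or by an end of the word, and each boundary
-- gives one way to shorten it; hence the coefficients 2, and Pascal's rule after division by a
-- power of 2. Erasing a peak gives the source terms, so three peaks need the counts for two, and
-- these the counts for one. Three peaks leave four run lengths. In {2,m,n-1} the outer runs have
-- length 1, and shortening one would put a peak at an end of the word, where the count is zero; so
-- only two arguments move. The boundary values are zero as well: an inner run of length 0 makes two
-- peaks adjacent, and the closed forms vanish there. These contain subtractions, which is why they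
-- live in the integers.

module Insertion where

  open import Data.Nat using (_+_; _*_; _≟_; _<ᵇ_)
  open import Data.Nat.Properties

  -- Permutations generated by inserting the maximum

  inserts : ℕ → List ℕ → List (List ℕ)
  inserts x []      = (x ∷ []) ∷ []
  inserts x (a ∷ w) = (x ∷ a ∷ w) ∷ map (a ∷_) (inserts x w)

  perms : ℕ → List (List ℕ)
  perms zero    = [] ∷ []
  perms (suc n) = concatMap (inserts (suc n)) (perms n)

  Letters : ℕ → List ℕ → Set
  Letters n = All (λ a → 0 < a × a ≤ n)

  Unique-resp-↭ : ∀ {xs ys : List ℕ} → xs ↭ ys → Unique xs → Unique ys
  Unique-resp-↭ p = Permutationₛ.Unique-resp-↭ (setoid ℕ) (↭⇒↭ₛ p)

  concatMap-unique : ∀ {A B : Set} (f : A → List B) {xs} → Unique xs →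
    (∀ {x} → x ∈ xs → Unique (f x)) →
    (∀ {x y v} → x ∈ xs → y ∈ xs → v ∈ f x → v ∈ f y → x ≡ y) →
    Unique (concatMap f xs)
  concatMap-unique f {[]} _ _ _ = []
  concatMap-unique f {x ∷ xs} (x∉ ∷ u) each disj =
    Unique.++⁺ (each (here refl))
      (concatMap-unique f u (each ∘ there) (λ p q → disj (there p) (there q)))
      λ where
        (v∈fx , v∈rest) →
          let y , y∈xs , v∈fy = find (∈-concatMap⁻ f v∈rest)
          in All.lookup x∉ y∈xs (disj (here refl) (there y∈xs) v∈fx v∈fy)

  inserts-↭ : ∀ x w {v} → v ∈ inserts x w → v ↭ x ∷ w
  inserts-↭ x []      (here refl) = ↭-refl
  inserts-↭ x (a ∷ w) (here refl) = ↭-refl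
  inserts-↭ x (a ∷ w) (there p) with v , v∈ , refl ← ∈-map⁻ (a ∷_) p =
    ↭-trans (↭-prep a (inserts-↭ x w v∈)) (↭-swap a x ↭-refl)

  ∈-inserts : ∀ x u w → u ++ x ∷ w ∈ inserts x (u ++ w)
  ∈-inserts x []      []      = here refl
  ∈-inserts x []      (a ∷ w) = here refl
  ∈-inserts x (a ∷ u) w       = there (∈-map⁺ (a ∷_) (∈-inserts x u w))

  inserts-unique : ∀ x w → x ∉ w → Unique (inserts x w)
  inserts-unique x []      _  = [] ∷ []
  inserts-unique x (a ∷ w) x∉ =
    All.tabulate (λ p → λ where
      refl → let _ , _ , eq = ∈-map⁻ (a ∷_) p in x∉ (here (∷-injectiveˡ eq)))
    ∷ Unique.map⁺ ∷-injectiveʳ (inserts-unique x w (x∉ ∘ there))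

  delete : ℕ → List ℕ → List ℕ
  delete x = filter (λ a → ¬? (a ≟ x))

  delete-fresh : ∀ x w → x ∉ w → delete x w ≡ w
  delete-fresh x w x∉ = filter-all (λ a → ¬? (a ≟ x)) (All.map ≢-sym (¬Any⇒All¬ w x∉))

  -- Deleting the maximum recovers the word it was inserted into, so insertions into different words
  -- never coincide; this keeps `perms` free of repetitions.
  delete-insert : ∀ x w {v} → x ∉ w → v ∈ inserts x w → delete x v ≡ w
  delete-insert x []      x∉ (here refl) = filter-reject (λ a → ¬? (a ≟ x)) (λ ne → ne refl)
  delete-insert x (a ∷ w) x∉ (here refl) =
    trans (filter-reject (λ a → ¬? (a ≟ x)) (λ ne → ne refl)) (delete-fresh x (a ∷ w) x∉)
  delete-insert x (a ∷ w) x∉ (there p) with v , v∈ , refl ← ∈-map⁻ (a ∷_) p =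
    trans (filter-accept (λ a → ¬? (a ≟ x)) (λ eq → x∉ (here (sym eq))))
          (cong (a ∷_) (delete-insert x w (x∉ ∘ there) v∈))

  Letters⇒fresh : ∀ {n w} → Letters n w → suc n ∉ w
  Letters⇒fresh ls p = <-irrefl refl (proj₂ (All.lookup ls p))

  Letters-weaken : ∀ {n w} → Letters n w → Letters (suc n) w
  Letters-weaken = All.map (λ (l , u) → l , m≤n⇒m≤1+n u)

  Letters-strengthen : ∀ {n w} → Letters (suc n) w → suc n ∉ w → Letters n w
  Letters-strengthen {w = []}    []             _  = []
  Letters-strengthen {w = a ∷ w} ((l , u) ∷ ls) x∉ =
    (l , ≤-pred (≤∧≢⇒< u (λ eq → x∉ (here (sym eq))))) ∷ Letters-strengthen ls (x∉ ∘ there)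

  perms-sound : ∀ n {w} → w ∈ perms n → Unique w × length w ≡ n × Letters n w
  perms-sound zero    (here refl) = [] , refl , []
  perms-sound (suc n) p
    with u , u∈ , w∈ ← find (∈-concatMap⁻ (inserts (suc n)) {xs = perms n} p)
    with uniq , len , ls ← perms-sound n u∈ =
      Unique-resp-↭ (↭-sym w↭) (¬Any⇒All¬ u (Letters⇒fresh ls) ∷ uniq)
    , trans (↭-length w↭) (cong suc len)
    , All-resp-↭ (↭-sym w↭) ((s≤s z≤n , ≤-refl) ∷ Letters-weaken ls)
    where w↭ = inserts-↭ (suc n) u w∈

  remove-max : ∀ {n w} → Unique w → Letters (suc n) w → suc n ∈ w →
    ∃ λ u → w ∈ inserts (suc n) u × Unique u × Letters n u
  remove-max {n} uniq ls p
    with u , v , refl ← ∈-∃++ p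
    with (x∉ ∷ uniq′) ← Unique-resp-↭ (shift (suc n) u v) uniq
    with (_ ∷ ls′) ← All-resp-↭ (shift (suc n) u v) ls =
    u ++ v , ∈-inserts (suc n) u v , uniq′ , Letters-strengthen ls′ (All¬⇒¬Any x∉)

  -- The pigeonhole principle, by removal of the top letter. `perms-complete` uses it to see that a
  -- word of full length must contain its top letter.
  Letters-length : ∀ n {w} → Unique w → Letters n w → length w ≤ n
  Letters-length zero {[]} _ _ = z≤n
  Letters-length zero {a ∷ w} _ ((l , u) ∷ _) = ⊥-elim (<⇒≱ l u)
  Letters-length (suc n) {w} uniq ls with suc n ∈? w
  ... | no x∉ = m≤n⇒m≤1+n (Letters-length n uniq (Letters-strengthen ls x∉))
  ... | yes p with u , w∈ , uniq′ , ls′ ← remove-max uniq ls p =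
    subst (_≤ suc n) (sym (↭-length (inserts-↭ (suc n) u w∈))) (s≤s (Letters-length n uniq′ ls′))

  perms-complete : ∀ n {w} → Unique w → length w ≡ n → Letters n w → w ∈ perms n
  perms-complete zero {[]} _ _ _ = here refl
  perms-complete (suc n) {w} uniq len ls with suc n ∈? w
  ... | no x∉ = ⊥-elim (1+n≰n (subst (_≤ n) len (Letters-length n uniq (Letters-strengthen ls x∉))))
  ... | yes p with u , w∈ , uniq′ , ls′ ← remove-max uniq ls p =
    ∈-concatMap⁺ (inserts (suc n)) (lose (perms-complete n uniq′
      (suc-injective (trans (sym (↭-length (inserts-↭ (suc n) u w∈))) len)) ls′) w∈)

  perms-unique : ∀ n → Unique (perms n)
  perms-unique zero    = [] ∷ []
  perms-unique (suc n) = concatMap-unique (inserts (suc n)) (perms-unique n)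
    (λ w∈ → inserts-unique (suc n) _ (fresh w∈))
    (λ w∈ w′∈ p p′ → trans (sym (delete-insert (suc n) _ (fresh w∈) p)) (delete-insert (suc n) _ (fresh w′∈) p′))
    where
    fresh : ∀ {w} → w ∈ perms n → suc n ∉ w
    fresh w∈ = Letters⇒fresh (proj₂ (proj₂ (perms-sound n w∈)))

  words-sound : ∀ k n {w} → w ∈ words k n → length w ≡ k × Letters n w
  words-sound zero    n (here refl) = refl , []
  words-sound (suc k) n p
    with u , u∈ , w∈ ← find (∈-concatMap⁻ (λ w → map (λ a → a ∷ w) (map suc (upTo n))) {xs = words k n} p)
    with _ , a∈ , refl ← ∈-map⁻ (_∷ u) w∈
    with b , b∈ , refl ← ∈-map⁻ suc a∈
    with len , ls ← words-sound k n u∈ =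
    cong suc len , ((s≤s z≤n , ∈-upTo⁻ b∈) ∷ ls)

  words-complete : ∀ k n {w} → length w ≡ k → Letters n w → w ∈ words k n
  words-complete zero    n {[]}        _   _              = here refl
  words-complete (suc k) n {suc a ∷ w} len ((_ , u) ∷ ls) =
    ∈-concatMap⁺ (λ w → map (λ a → a ∷ w) (map suc (upTo n)))
      (lose (words-complete k n (suc-injective len) ls) (∈-map⁺ (_∷ w) (∈-map⁺ suc (∈-upTo⁺ u))))

  words-unique : ∀ k n → Unique (words k n)
  words-unique zero    n = [] ∷ []
  words-unique (suc k) n = concatMap-unique _ (words-unique k n)
    (λ _ → Unique.map⁺ ∷-injectiveˡ (Unique.map⁺ suc-injective (Unique.upTo⁺ n)))
    (λ {u} {v} _ _ p q →
      let _ , _ , eq = ∈-map⁻ (_∷ u) p ; _ , _ , eq′ = ∈-map⁻ (_∷ v) q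
      in ∷-injectiveʳ (trans (sym eq) eq′))

  -- The two lists come in different orders, but both are free of repetitions and have the same
  -- members. A rearrangement is enough, since only the length of a filtered list is taken.
  unique-words↭perms : ∀ n → filter unique? (words n n) ↭ perms n
  unique-words↭perms n = ∼bag⇒↭ (unique∧set⇒bag
    (Unique.filter⁺ unique? (words-unique n n)) (perms-unique n)
    (mk⇔ (λ p → let w∈ , u = ∈-filter⁻ unique? {xs = words n n} p ; len , ls = words-sound n n w∈
                in perms-complete n u len ls)
         (λ p → let u , len , ls = perms-sound n p
                in ∈-filter⁺ unique? (words-complete n n len ls) u)))

  filter-×-dec : ∀ {A : Set} {P Q : A → Set} (P? : Decidable P) (Q? : Decidable Q) xs →
    filter (λ x → P? x ×-dec Q? x) xs ≡ filter Q? (filter P? xs)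
  filter-×-dec P? Q? [] = refl
  filter-×-dec P? Q? (x ∷ xs) with P? x
  ... | no _ = filter-×-dec P? Q? xs
  ... | yes _ with Q? x
  ...   | yes _ = cong (x ∷_) (filter-×-dec P? Q? xs)
  ...   | no _  = filter-×-dec P? Q? xs

  #P-perms : ∀ S n → #P S n ≡ length (filter (λ w → ≡-dec _≟_ (peaks w) S) (perms n))
  #P-perms S n = trans
    (cong length (filter-×-dec unique? (λ w → ≡-dec _≟_ (peaks w) S) (words n n)))
    (↭-length (filter-↭ _ (unique-words↭perms n)))

  -- Peak sets as status words

  <ᵇ-true : ∀ {a b} → a < b → (a <ᵇ b) ≡ true
  <ᵇ-true {a} {b} a<b with a <ᵇ b | <⇒<ᵇ a<b
  ... | true | _ = refl

  <ᵇ-false : ∀ {a b} → b ≤ a → (a <ᵇ b) ≡ false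
  <ᵇ-false {a} {b} b≤a with a <ᵇ b in eq
  ... | false = refl
  ... | true  = ⊥-elim (<⇒≱ (<ᵇ⇒< a b (subst T (sym eq) _)) b≤a)

  -- The peak indicator of every letter of a word; the flag tells whether the
  -- first letter is preceded by a smaller one.
  statusFrom : Bool → List ℕ → List Bool
  statusFrom up []          = []
  statusFrom up (a ∷ [])    = false ∷ []
  statusFrom up (a ∷ b ∷ w) = (up ∧ (b <ᵇ a)) ∷ statusFrom (a <ᵇ b) (b ∷ w)

  status : List ℕ → List Bool
  status = statusFrom false

  positions : ℕ → List Bool → List ℕ
  positions i []          = []
  positions i (true ∷ s)  = i ∷ positions (suc i) s
  positions i (false ∷ s) = positions (suc i) s

  peaksFrom-positions : ∀ i a b w → peaksFrom i (a ∷ b ∷ w) ≡ positions i (statusFrom (a <ᵇ b) (b ∷ w))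
  peaksFrom-positions i a b []      = refl
  peaksFrom-positions i a b (c ∷ w) with (a <ᵇ b) ∧ (c <ᵇ b)
  ... | true  = cong (i ∷_) (peaksFrom-positions (suc i) b c w)
  ... | false = peaksFrom-positions (suc i) b c w

  peaks-positions : ∀ w → peaks w ≡ positions 1 (status w)
  peaks-positions []          = refl
  peaks-positions (a ∷ [])    = refl
  peaks-positions (a ∷ b ∷ w) = peaksFrom-positions 2 a b w

  statusFrom-length : ∀ up w → length (statusFrom up w) ≡ length w
  statusFrom-length up []          = refl
  statusFrom-length up (a ∷ [])    = refl
  statusFrom-length up (a ∷ b ∷ w) = cong suc (statusFrom-length (a <ᵇ b) (b ∷ w))

  positions-≥ : ∀ i s → All (i ≤_) (positions i s)
  positions-≥ i []          = []
  positions-≥ i (true ∷ s)  = ≤-refl ∷ All.map (≤-trans (n≤1+n i)) (positions-≥ (suc i) s)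
  positions-≥ i (false ∷ s) = All.map (≤-trans (n≤1+n i)) (positions-≥ (suc i) s)

  positions-fresh : ∀ i s {l} → ¬ (i ∷ l ≡ positions (suc i) s)
  positions-fresh i s eq with positions (suc i) s | positions-≥ (suc i) s
  positions-fresh i s refl | _ | i<i ∷ _ = 1+n≰n i<i

  -- Trailing `false` entries leave no trace among the positions; the equality of lengths accounts
  -- for them.
  positions-injective : ∀ i s t → length s ≡ length t → positions i s ≡ positions i t → s ≡ t
  positions-injective i []          []          _   _  = refl
  positions-injective i (true ∷ s)  (true ∷ t)  len eq =
    cong (true ∷_) (positions-injective (suc i) s t (suc-injective len) (∷-injectiveʳ eq))
  positions-injective i (false ∷ s) (false ∷ t) len eq =
    cong (false ∷_) (positions-injective (suc i) s t (suc-injective len) eq)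
  positions-injective i (true ∷ s)  (false ∷ t) _ eq = ⊥-elim (positions-fresh i t eq)
  positions-injective i (false ∷ s) (true ∷ t)  _ eq = ⊥-elim (positions-fresh i s (sym eq))

  -- Counting permutations by status word

  ∑ : ∀ {A : Set} → (A → ℕ) → List A → ℕ
  ∑ f xs = sum (map f xs)

  ∑-cong-∈ : ∀ {A : Set} {f g : A → ℕ} xs → (∀ {x} → x ∈ xs → f x ≡ g x) → ∑ f xs ≡ ∑ g xs
  ∑-cong-∈ []       eq = refl
  ∑-cong-∈ (x ∷ xs) eq = cong₂ _+_ (eq (here refl)) (∑-cong-∈ xs (eq ∘ there))

  ∑-zero : ∀ {A : Set} {f : A → ℕ} → ∀ xs → (∀ {x} → x ∈ xs → f x ≡ 0) → ∑ f xs ≡ 0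
  ∑-zero []       eq = refl
  ∑-zero (x ∷ xs) eq = cong₂ _+_ (eq (here refl)) (∑-zero xs (eq ∘ there))

  ∑-map : ∀ {A B : Set} (f : B → ℕ) (g : A → B) xs → ∑ f (map g xs) ≡ ∑ (f ∘ g) xs
  ∑-map f g xs = cong sum (sym (map-∘ xs))

  ∑-concatMap : ∀ {A B : Set} (f : B → ℕ) (g : A → List B) xs →
    ∑ f (concatMap g xs) ≡ ∑ (λ x → ∑ f (g x)) xs
  ∑-concatMap f g []       = refl
  ∑-concatMap f g (x ∷ xs) = begin
    sum (map f (g x ++ concatMap g xs))         ≡⟨ cong sum (map-++ f (g x) _) ⟩
    sum (map f (g x) ++ map f (concatMap g xs)) ≡⟨ sum-++ (map f (g x)) _ ⟩
    ∑ f (g x) + ∑ f (concatMap g xs)            ≡⟨ cong (∑ f (g x) +_) (∑-concatMap f g xs) ⟩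
    ∑ f (g x) + ∑ (λ x → ∑ f (g x)) xs          ∎

  interchange : ∀ a b c d → (a + b) + (c + d) ≡ (a + c) + (b + d)
  interchange = solve 4 (λ a b c d → (a :+ b) :+ (c :+ d) := (a :+ c) :+ (b :+ d)) refl
    where open ℕ-Solver

  ∑-+ : ∀ {A : Set} (f g : A → ℕ) xs → ∑ (λ x → f x + g x) xs ≡ ∑ f xs + ∑ g xs
  ∑-+ f g []       = refl
  ∑-+ f g (x ∷ xs) = trans (cong (f x + g x +_) (∑-+ f g xs)) (interchange (f x) (g x) _ _)

  -- The Kronecker delta, by structural recursion so that equal leading entries cancel by
  -- computation.
  ind : List Bool → List Bool → ℕ
  ind []          []          = 1
  ind (true ∷ s)  (true ∷ t)  = ind s t
  ind (false ∷ s) (false ∷ t) = ind s t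
  ind _           _           = 0

  ind-refl : ∀ s → ind s s ≡ 1
  ind-refl []          = refl
  ind-refl (true ∷ s)  = ind-refl s
  ind-refl (false ∷ s) = ind-refl s

  ind-≢ : ∀ s t → s ≢ t → ind s t ≡ 0
  ind-≢ []          []          ne = ⊥-elim (ne refl)
  ind-≢ []          (_ ∷ _)     ne = refl
  ind-≢ (true ∷ s)  []          ne = refl
  ind-≢ (false ∷ s) []          ne = refl
  ind-≢ (true ∷ s)  (true ∷ t)  ne = ind-≢ s t (ne ∘ cong (true ∷_))
  ind-≢ (true ∷ s)  (false ∷ t) ne = refl
  ind-≢ (false ∷ s) (true ∷ t)  ne = refl
  ind-≢ (false ∷ s) (false ∷ t) ne = ind-≢ s t (ne ∘ cong (false ∷_))

  -- The number of permutations of {1,…,n} with a prescribed status word.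
  N : ℕ → List Bool → ℕ
  N n τ = ∑ (λ w → ind (status w) τ) (perms n)

  filter-status : ∀ τ ws → (∀ {w} → w ∈ ws → length w ≡ length τ) →
    length (filter (λ w → ≡-dec _≟_ (peaks w) (positions 1 τ)) ws) ≡ ∑ (λ w → ind (status w) τ) ws
  filter-status τ []       _   = refl
  filter-status τ (w ∷ ws) len with ≡-dec _≟_ (peaks w) (positions 1 τ)
  ... | yes eq = cong₂ _+_
    (sym (trans (cong (λ s → ind s τ) (positions-injective 1 (status w) τ
      (trans (statusFrom-length false w) (len (here refl))) (trans (sym (peaks-positions w)) eq)))
      (ind-refl τ)))
    (filter-status τ ws (len ∘ there))
  ... | no ne = cong₂ _+_
    (sym (ind-≢ (status w) τ (λ eq → ne (trans (peaks-positions w) (cong (positions 1) eq)))))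
    (filter-status τ ws (len ∘ there))

  #P-N : ∀ τ → #P (positions 1 τ) (length τ) ≡ N (length τ) τ
  #P-N τ = trans (#P-perms (positions 1 τ) (length τ))
    (filter-status τ (perms (length τ)) (λ w∈ → proj₁ (proj₂ (perms-sound (length τ) w∈))))

  -- A new maximum inserted behind the first letter becomes a peak (unless it
  -- comes last) and its two neighbours lose that status.
  insertions : List Bool → List (List Bool)
  insertions []          = (false ∷ []) ∷ []
  insertions (p ∷ [])    = (p ∷ false ∷ []) ∷ []
  insertions (p ∷ q ∷ s) = (false ∷ true ∷ false ∷ s) ∷ map (p ∷_) (insertions (q ∷ s))

  -- The flag `up` influences only the first indicator, and the insertion right before `b`
  -- overwrites that one with `false`.
  insertions-∷ : ∀ p up b w → insertions (p ∷ statusFrom up (b ∷ w)) ≡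
    (false ∷ true ∷ statusFrom false (b ∷ w)) ∷ map (p ∷_) (insertions (statusFrom up (b ∷ w)))
  insertions-∷ p up b []      = refl
  insertions-∷ p up b (c ∷ w) = refl

  -- A letter above all others decides every comparison it takes part in, so the new status words
  -- depend on the old one alone. This is where the letters leave the argument.
  status-inserts : ∀ {x} up a w → All (_< x) (a ∷ w) →
    map (λ v → statusFrom up (a ∷ v)) (inserts x w) ≡ insertions (statusFrom up (a ∷ w))
  status-inserts {x} up a [] (a<x ∷ _)
    rewrite <ᵇ-false (<⇒≤ a<x) | ∧-zeroʳ up = refl
  status-inserts {x} up a (b ∷ w) (a<x ∷ b<x ∷ w<x)
    rewrite <ᵇ-false (<⇒≤ a<x) | ∧-zeroʳ up | <ᵇ-true a<x | <ᵇ-true b<x | <ᵇ-false (<⇒≤ b<x) = begin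
    _ ∷ map (λ v → statusFrom up (a ∷ v)) (map (b ∷_) (inserts x w))
      ≡⟨ cong (_ ∷_) (sym (map-∘ (inserts x w))) ⟩
    _ ∷ map (λ v → (up ∧ (b <ᵇ a)) ∷ statusFrom (a <ᵇ b) (b ∷ v)) (inserts x w)
      ≡⟨ cong (_ ∷_) (map-∘ (inserts x w)) ⟩
    _ ∷ map ((up ∧ (b <ᵇ a)) ∷_) (map (λ v → statusFrom (a <ᵇ b) (b ∷ v)) (inserts x w))
      ≡⟨ cong (λ l → _ ∷ map ((up ∧ (b <ᵇ a)) ∷_) l) (status-inserts (a <ᵇ b) b w (b<x ∷ w<x)) ⟩
    _ ∷ map ((up ∧ (b <ᵇ a)) ∷_) (insertions (statusFrom (a <ᵇ b) (b ∷ w)))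
      ≡⟨ sym (insertions-∷ (up ∧ (b <ᵇ a)) (a <ᵇ b) b w) ⟩
    insertions (statusFrom up (a ∷ b ∷ w)) ∎

  -- preimages f τ is the sum of f over all ways in which τ is one of the
  -- insertions into some word; collapse f τ is the part of it in which the
  -- insertion affects the first letter of τ.
  collapse : (List Bool → ℕ) → List Bool → ℕ
  collapse f (false ∷ [])               = f []
  collapse f (false ∷ true ∷ false ∷ s) =
    f (false ∷ false ∷ s) + f (false ∷ true ∷ s) + f (true ∷ false ∷ s) + f (true ∷ true ∷ s)
  collapse f _                          = 0

  preimages : (List Bool → ℕ) → List Bool → ℕ
  preimages f []      = 0
  preimages f (t ∷ τ) = collapse f (t ∷ τ) + preimages (f ∘ (t ∷_)) τ

  -- The share of the insertion before the whole word; it is separate because `insertions` covers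
  -- only the places behind the first letter.
  front : (List Bool → ℕ) → List Bool → ℕ
  front f (false ∷ τ) = f τ
  front f _           = 0

  collapse-+ : ∀ f g τ → collapse (λ π → f π + g π) τ ≡ collapse f τ + collapse g τ
  collapse-+ f g []                            = refl
  collapse-+ f g (true ∷ τ)                    = refl
  collapse-+ f g (false ∷ [])                  = refl
  collapse-+ f g (false ∷ false ∷ τ)           = refl
  collapse-+ f g (false ∷ true ∷ [])           = refl
  collapse-+ f g (false ∷ true ∷ true ∷ s)     = refl
  collapse-+ f g (false ∷ true ∷ false ∷ s)    =
    solve 8 (λ a b c d a′ b′ c′ d′ →
        (a :+ a′) :+ (b :+ b′) :+ (c :+ c′) :+ (d :+ d′) := (a :+ b :+ c :+ d) :+ (a′ :+ b′ :+ c′ :+ d′)) refl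
      (f (false ∷ false ∷ s)) (f (false ∷ true ∷ s)) (f (true ∷ false ∷ s)) (f (true ∷ true ∷ s))
      (g (false ∷ false ∷ s)) (g (false ∷ true ∷ s)) (g (true ∷ false ∷ s)) (g (true ∷ true ∷ s))
    where open ℕ-Solver

  collapse-zero : ∀ f τ → (∀ π → f π ≡ 0) → collapse f τ ≡ 0
  collapse-zero f []                         z = refl
  collapse-zero f (true ∷ τ)                 z = refl
  collapse-zero f (false ∷ [])               z = z []
  collapse-zero f (false ∷ false ∷ τ)        z = refl
  collapse-zero f (false ∷ true ∷ [])        z = refl
  collapse-zero f (false ∷ true ∷ true ∷ s)  z = refl
  collapse-zero f (false ∷ true ∷ false ∷ s) z =
    cong₂ _+_ (cong₂ _+_ (cong₂ _+_ (z _) (z _)) (z _)) (z _)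

  preimages-+ : ∀ f g τ → preimages (λ π → f π + g π) τ ≡ preimages f τ + preimages g τ
  preimages-+ f g []      = refl
  preimages-+ f g (t ∷ τ) = trans
    (cong₂ _+_ (collapse-+ f g (t ∷ τ)) (preimages-+ (f ∘ (t ∷_)) (g ∘ (t ∷_)) τ))
    (interchange (collapse f (t ∷ τ)) (collapse g (t ∷ τ)) _ _)

  preimages-zero : ∀ f τ → (∀ π → f π ≡ 0) → preimages f τ ≡ 0
  preimages-zero f []      z = refl
  preimages-zero f (t ∷ τ) z = cong₂ _+_ (collapse-zero f (t ∷ τ) z) (preimages-zero (f ∘ (t ∷_)) τ (z ∘ (t ∷_)))

  -- By linearity of `preimages` in its function argument, an identity for a single permutation
  -- becomes one for the counts `N`.
  ∑-preimages : ∀ {A : Set} (g : A → List Bool → ℕ) τ xs →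
    ∑ (λ x → preimages (g x) τ) xs ≡ preimages (λ π → ∑ (λ x → g x π) xs) τ
  ∑-preimages g τ []       = sym (preimages-zero (λ _ → 0) τ (λ _ → refl))
  ∑-preimages g τ (x ∷ xs) = trans (cong (preimages (g x) τ +_) (∑-preimages g τ xs))
                                   (sym (preimages-+ (g x) _ τ))

  ∑-front : ∀ {A : Set} (g : A → List Bool → ℕ) τ xs →
    ∑ (λ x → front (g x) τ) xs ≡ front (λ π → ∑ (λ x → g x π) xs) τ
  ∑-front g []          xs = ∑-zero xs (λ _ → refl)
  ∑-front g (true ∷ τ)  xs = ∑-zero xs (λ _ → refl)
  ∑-front g (false ∷ τ) xs = refl

  ind-front : ∀ σ τ → ind (false ∷ σ) τ ≡ front (ind σ) τ
  ind-front σ []          = refl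
  ind-front σ (true ∷ τ)  = refl
  ind-front σ (false ∷ τ) = refl

  collapse-ind₁ : ∀ p τ → collapse (ind (p ∷ [])) τ ≡ 0
  collapse-ind₁ p     []                         = refl
  collapse-ind₁ p     (true ∷ τ)                 = refl
  collapse-ind₁ true  (false ∷ [])               = refl
  collapse-ind₁ false (false ∷ [])               = refl
  collapse-ind₁ p     (false ∷ false ∷ τ)        = refl
  collapse-ind₁ p     (false ∷ true ∷ [])        = refl
  collapse-ind₁ p     (false ∷ true ∷ true ∷ s)  = refl
  collapse-ind₁ true  (false ∷ true ∷ false ∷ s) = refl
  collapse-ind₁ false (false ∷ true ∷ false ∷ s) = refl

  -- The four words summed by `collapse` run through all choices of the first two entries, so at
  -- most one of them can agree with `p` and `q`.
  collapse-ind₂ : ∀ p q s τ → collapse (ind (p ∷ q ∷ s)) τ ≡ ind (false ∷ true ∷ false ∷ s) τ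
  collapse-ind₂ p     q     s []                          = refl
  collapse-ind₂ p     q     s (true ∷ τ)                  = refl
  collapse-ind₂ true  q     s (false ∷ [])                = refl
  collapse-ind₂ false q     s (false ∷ [])                = refl
  collapse-ind₂ p     q     s (false ∷ false ∷ τ)         = refl
  collapse-ind₂ p     q     s (false ∷ true ∷ [])         = refl
  collapse-ind₂ p     q     s (false ∷ true ∷ true ∷ τ)   = refl
  collapse-ind₂ true  true  s (false ∷ true ∷ false ∷ τ) = refl
  collapse-ind₂ true  false s (false ∷ true ∷ false ∷ τ) = +-identityʳ _
  collapse-ind₂ false true  s (false ∷ true ∷ false ∷ τ) = trans (+-identityʳ _) (+-identityʳ _)
  collapse-ind₂ false false s (false ∷ true ∷ false ∷ τ) =
    trans (+-identityʳ _) (trans (+-identityʳ _) (+-identityʳ _))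

  ∑-ind-∷ : ∀ p σ t τ → (∀ τ → ∑ (λ ρ → ind ρ τ) (insertions σ) ≡ preimages (ind σ) τ) →
    ∑ (λ ρ → ind ρ (t ∷ τ)) (map (p ∷_) (insertions σ)) ≡ preimages (λ π → ind (p ∷ σ) (t ∷ π)) τ
  ∑-ind-∷ true  σ true  τ ih = trans (∑-map _ (true ∷_) (insertions σ)) (ih τ)
  ∑-ind-∷ false σ false τ ih = trans (∑-map _ (false ∷_) (insertions σ)) (ih τ)
  ∑-ind-∷ true  σ false τ ih = trans (∑-map _ (true ∷_) (insertions σ))
    (trans (∑-zero (insertions σ) (λ _ → refl)) (sym (preimages-zero _ τ (λ _ → refl))))
  ∑-ind-∷ false σ true  τ ih = trans (∑-map _ (false ∷_) (insertions σ))
    (trans (∑-zero (insertions σ) (λ _ → refl)) (sym (preimages-zero _ τ (λ _ → refl))))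

  -- The transposition: on the left the outcomes of a fixed source `σ` are compared with `τ`, on the
  -- right the sources of a fixed outcome `τ` are compared with `σ`.
  ∑-insertions : ∀ σ τ → ∑ (λ ρ → ind ρ τ) (insertions σ) ≡ preimages (ind σ) τ
  ∑-insertions []          []                         = refl
  ∑-insertions []          (true ∷ τ)                 = sym (preimages-zero _ τ (λ _ → refl))
  ∑-insertions []          (false ∷ [])               = refl
  ∑-insertions []          (false ∷ false ∷ τ)        = sym (preimages-zero _ (false ∷ τ) (λ _ → refl))
  ∑-insertions []          (false ∷ true ∷ [])        = refl
  ∑-insertions []          (false ∷ true ∷ true ∷ τ)  = sym (preimages-zero _ (true ∷ τ) (λ _ → refl))
  ∑-insertions []          (false ∷ true ∷ false ∷ τ) = sym (preimages-zero _ (false ∷ τ) (λ _ → refl))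
  ∑-insertions (true ∷ [])    []                      = refl
  ∑-insertions (false ∷ [])   []                      = refl
  ∑-insertions (p ∷ [])    (t ∷ τ) = trans
    (∑-ind-∷ p [] t τ (∑-insertions []))
    (sym (cong (_+ preimages _ τ) (collapse-ind₁ p (t ∷ τ))))
  ∑-insertions (p ∷ q ∷ s) []      = trans (∑-map _ (p ∷_) (insertions (q ∷ s)))
    (∑-zero (insertions (q ∷ s)) (λ {ρ} _ → ind-≢ (p ∷ ρ) [] (λ ())))
  ∑-insertions (p ∷ q ∷ s) (t ∷ τ) = cong₂ _+_
    (sym (collapse-ind₂ p q s (t ∷ τ)))
    (∑-ind-∷ p (q ∷ s) t τ (∑-insertions (q ∷ s)))

  -- The recurrence starts from permutations of at least one letter: for the empty one, insertion in
  -- front and insertion at the end coincide and would be counted twice.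
  N-suc : ∀ n τ → N (2 + n) τ ≡ front (N (suc n)) τ + preimages (N (suc n)) τ
  N-suc n τ = begin
    N (2 + n) τ
      ≡⟨ ∑-concatMap (λ w → ind (status w) τ) (inserts (2 + n)) (perms (suc n)) ⟩
    ∑ (λ w → ∑ (λ v → ind (status v) τ) (inserts (2 + n) w)) (perms (suc n))
      ≡⟨ ∑-cong-∈ (perms (suc n)) step ⟩
    ∑ (λ w → front (ind (status w)) τ + preimages (ind (status w)) τ) (perms (suc n))
      ≡⟨ ∑-+ (λ w → front (ind (status w)) τ) _ (perms (suc n)) ⟩
    ∑ (λ w → front (ind (status w)) τ) (perms (suc n)) + ∑ (λ w → preimages (ind (status w)) τ) (perms (suc n))
      ≡⟨ cong₂ _+_ (∑-front (ind ∘ status) τ (perms (suc n))) (∑-preimages (ind ∘ status) τ (perms (suc n))) ⟩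
    front (N (suc n)) τ + preimages (N (suc n)) τ ∎
    where
    step : ∀ {w} → w ∈ perms (suc n) →
      ∑ (λ v → ind (status v) τ) (inserts (2 + n) w) ≡ front (ind (status w)) τ + preimages (ind (status w)) τ
    step {w} w∈ with perms-sound (suc n) w∈
    step {a ∷ w} w∈ | _ , _ , ls@((_ , a≤) ∷ _) = cong₂ _+_
      (trans (cong (λ b → ind (false ∷ statusFrom b (a ∷ w)) τ) (<ᵇ-false (<⇒≤ (s≤s a≤))))
             (ind-front (status (a ∷ w)) τ))
      (begin
        ∑ (λ v → ind (status v) τ) (map (a ∷_) (inserts (2 + n) w))
          ≡⟨ ∑-map _ (a ∷_) (inserts (2 + n) w) ⟩
        ∑ (λ v → ind (status (a ∷ v)) τ) (inserts (2 + n) w)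
          ≡⟨ sym (∑-map (λ ρ → ind ρ τ) (λ v → status (a ∷ v)) (inserts (2 + n) w)) ⟩
        ∑ (λ ρ → ind ρ τ) (map (λ v → status (a ∷ v)) (inserts (2 + n) w))
          ≡⟨ cong (∑ (λ ρ → ind ρ τ)) (status-inserts false a w (All.map (λ (_ , b≤) → s≤s b≤) ls)) ⟩
        ∑ (λ ρ → ind ρ τ) (insertions (status (a ∷ w)))
          ≡⟨ ∑-insertions (status (a ∷ w)) τ ⟩
        preimages (ind (status (a ∷ w))) τ ∎)

  -- Status words that cannot occur

  data Bad : List Bool → Set where
    last  : Bad (true ∷ [])
    twin  : ∀ {s} → Bad (true ∷ true ∷ s)
    later : ∀ {t s} → Bad s → Bad (t ∷ s)

  ind-twin : ∀ up a b w s → ind (statusFrom up (a ∷ b ∷ w)) (true ∷ true ∷ s) ≡ 0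
  ind-twin false a b w s = refl
  ind-twin true  a b w s with b <ᵇ a in eq
  ... | false = refl
  -- If `a` is a peak then `b` is preceded by a larger letter, so its flag is `false` and it cannot
  -- be a peak.
  ... | true rewrite <ᵇ-false (<⇒≤ (<ᵇ⇒< b a (subst T (sym eq) _))) with w
  ...   | []    = refl
  ...   | _ ∷ _ = refl

  ind-bad : ∀ up w {τ} → Bad τ → ind (statusFrom up w) τ ≡ 0
  ind-bad up []                last  = refl
  ind-bad up (a ∷ [])          last  = refl
  ind-bad up (a ∷ b ∷ [])      last  = ind-≢ ((up ∧ (b <ᵇ a)) ∷ _) (true ∷ []) (λ ())
  ind-bad up (a ∷ b ∷ c ∷ w)   last  = ind-≢ ((up ∧ (b <ᵇ a)) ∷ ((a <ᵇ b) ∧ (c <ᵇ b)) ∷ _) (true ∷ []) (λ ())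
  ind-bad up []                twin  = refl
  ind-bad up (a ∷ [])          twin  = refl
  ind-bad up (a ∷ b ∷ w) (twin {s}) = ind-twin up a b w s
  ind-bad up []          (later bad) = refl
  ind-bad up (a ∷ [])    (later {true} bad) = refl
  ind-bad up (a ∷ [])    (later {false} bad) = ind-bad false [] bad
  ind-bad up (a ∷ b ∷ w) (later {t} bad) with up ∧ (b <ᵇ a) | t
  ... | true  | true  = ind-bad (a <ᵇ b) (b ∷ w) bad
  ... | false | false = ind-bad (a <ᵇ b) (b ∷ w) bad
  ... | true  | false = refl
  ... | false | true  = refl

  N-bad : ∀ n {τ} → Bad τ → N n τ ≡ 0
  N-bad n bad = ∑-zero (perms n) (λ {w} _ → ind-bad false w bad)

  N-first : ∀ n τ → N n (true ∷ τ) ≡ 0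
  N-first n τ = ∑-zero (perms n) (λ {w} _ → first w)
    where
    first : ∀ w → ind (status w) (true ∷ τ) ≡ 0
    first []          = refl
    first (a ∷ [])    = refl
    first (a ∷ b ∷ w) = refl

  -- Recurrences in the run lengths

  infixr 5 _·_
  _·_ : ℕ → List Bool → List Bool
  k · s = replicate k false ++ s

  -- The arguments are the lengths of the runs between the peaks, not positions: in these
  -- coordinates a recurrence step lowers one argument or merges two.
  one : ℕ → ℕ → List Bool
  one i j = i · true ∷ j · []

  two : ℕ → ℕ → ℕ → List Bool
  two i k j = i · true ∷ one k j

  three : ℕ → ℕ → ℕ → ℕ → List Bool
  three i k l j = i · true ∷ two k l j

  bad-· : ∀ k {s} → Bad s → Bad (k · s)
  bad-· zero    bad = bad
  bad-· (suc k) bad = later (bad-· k bad)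

  -- Up to the first peak, the pattern that `collapse` recognises occurs only around that peak. Its
  -- four sources erase the peak, shorten the right run, shorten the left run, or have two adjacent
  -- peaks; the last summand treats what follows the peak.
  preimages-· : ∀ f k l s → preimages f (suc k · true ∷ suc l · s) ≡
    f ((2 + k + l) · s) + f (suc k · true ∷ l · s) + f (k · true ∷ suc l · s) + f (k · true ∷ true ∷ l · s)
    + preimages (λ z → f (suc k · true ∷ z)) (suc l · s)
  preimages-· f zero    l s = refl
  preimages-· f (suc k) l s = preimages-· (f ∘ (false ∷_)) k l s

  preimages-end : ∀ f j → preimages f (suc j · []) ≡ f (j · [])
  preimages-end f zero    = +-identityʳ (f [])
  preimages-end f (suc j) = preimages-end (f ∘ (false ∷_)) j

  N-zero-suc : ∀ n k → N (2 + n) (suc k · []) ≡ 2 * N (suc n) (k · [])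
  N-zero-suc n k = begin
    N (2 + n) (suc k · [])
      ≡⟨ N-suc n (suc k · []) ⟩
    N (suc n) (k · []) + preimages (N (suc n)) (suc k · [])
      ≡⟨ cong (N (suc n) (k · []) +_) (trans (preimages-end (N (suc n)) k) (sym (+-identityʳ _))) ⟩
    2 * N (suc n) (k · []) ∎

  -- The left run is shortened by insertion in front and by the peak, the right run by the peak and
  -- by insertion at the end; this gives the two factors 2. With more peaks, an inner run is
  -- shortened by both of its neighbouring peaks.
  N-one-suc : ∀ n i j → let N′ = N (suc n) in
    N (2 + n) (one (suc i) (suc j)) ≡
    N′ ((2 + i + j) · []) + 2 * N′ (one i (suc j)) + 2 * N′ (one (suc i) j)
  N-one-suc n i j = begin
    N (2 + n) (one (suc i) (suc j))
      ≡⟨ N-suc n (one (suc i) (suc j)) ⟩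
    N′ (one i (suc j)) + preimages N′ (one (suc i) (suc j))
      ≡⟨ cong (N′ (one i (suc j)) +_) (preimages-· N′ i j []) ⟩
    N′ (one i (suc j)) + (N′ ((2 + i + j) · []) + N′ (one (suc i) j) + N′ (one i (suc j))
      + N′ (i · true ∷ true ∷ j · []) + preimages (λ z → N′ (suc i · true ∷ z)) (suc j · []))
      ≡⟨ cong₂ (λ u v → N′ (one i (suc j)) + (N′ ((2 + i + j) · []) + N′ (one (suc i) j) + N′ (one i (suc j)) + u + v))
           (N-bad (suc n) (bad-· i twin)) (preimages-end (λ z → N′ (suc i · true ∷ z)) j) ⟩
    N′ (one i (suc j)) + (N′ ((2 + i + j) · []) + N′ (one (suc i) j) + N′ (one i (suc j)) + 0 + N′ (one (suc i) j))
      ≡⟨ solve 3 (λ a b c → a :+ (b :+ c :+ a :+ con 0 :+ c) := b :+ con 2 :* a :+ con 2 :* c) refl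
           (N′ (one i (suc j))) (N′ ((2 + i + j) · [])) (N′ (one (suc i) j)) ⟩
    N′ ((2 + i + j) · []) + 2 * N′ (one i (suc j)) + 2 * N′ (one (suc i) j) ∎
    where
    open ℕ-Solver
    N′ = N (suc n)

  N-two-suc : ∀ n i k j → let N′ = N (suc n) in
    N (2 + n) (two (suc i) (suc k) (suc j)) ≡
    N′ (one (2 + i + k) (suc j)) + N′ (one (suc i) (2 + k + j))
    + 2 * N′ (two i (suc k) (suc j)) + 2 * N′ (two (suc i) k (suc j)) + 2 * N′ (two (suc i) (suc k) j)
  N-two-suc n i k j = begin
    N (2 + n) (two (suc i) (suc k) (suc j))
      ≡⟨ N-suc n (two (suc i) (suc k) (suc j)) ⟩
    a + preimages N′ (two (suc i) (suc k) (suc j))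
      ≡⟨ cong (a +_) (preimages-· N′ i k (true ∷ suc j · [])) ⟩
    a + (x + b + a + N′ (i · true ∷ true ∷ k · true ∷ suc j · [])
      + preimages (λ z → N′ (suc i · true ∷ z)) (one (suc k) (suc j)))
      ≡⟨ cong₂ (λ u v → a + (x + b + a + u + v)) (N-bad (suc n) (bad-· i twin))
           (preimages-· (λ z → N′ (suc i · true ∷ z)) k j []) ⟩
    a + (x + b + a + 0 + (y + c + b + N′ (suc i · true ∷ k · true ∷ true ∷ j · [])
      + preimages (λ z → N′ (suc i · true ∷ suc k · true ∷ z)) (suc j · [])))
      ≡⟨ cong₂ (λ u v → a + (x + b + a + 0 + (y + c + b + u + v)))
           (N-bad (suc n) (bad-· (suc i) (later (bad-· k twin))))
           (preimages-end (λ z → N′ (suc i · true ∷ suc k · true ∷ z)) j) ⟩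
    a + (x + b + a + 0 + (y + c + b + 0 + c))
      ≡⟨ solve 5 (λ a b c x y → a :+ (x :+ b :+ a :+ con 0 :+ (y :+ c :+ b :+ con 0 :+ c))
                    := x :+ y :+ con 2 :* a :+ con 2 :* b :+ con 2 :* c) refl a b c x y ⟩
    x + y + 2 * a + 2 * b + 2 * c ∎
    where
    open ℕ-Solver
    N′ = N (suc n)
    a = N′ (two i (suc k) (suc j))
    b = N′ (two (suc i) k (suc j))
    c = N′ (two (suc i) (suc k) j)
    x = N′ (one (2 + i + k) (suc j))
    y = N′ (one (suc i) (2 + k + j))

  N-three-suc : ∀ n i k l j → let N′ = N (suc n) in
    N (2 + n) (three (suc i) (suc k) (suc l) (suc j)) ≡
    N′ (two (2 + i + k) (suc l) (suc j)) + N′ (two (suc i) (2 + k + l) (suc j)) + N′ (two (suc i) (suc k) (2 + l + j))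
    + 2 * N′ (three i (suc k) (suc l) (suc j)) + 2 * N′ (three (suc i) k (suc l) (suc j))
    + 2 * N′ (three (suc i) (suc k) l (suc j)) + 2 * N′ (three (suc i) (suc k) (suc l) j)
  N-three-suc n i k l j = begin
    N (2 + n) (three (suc i) (suc k) (suc l) (suc j))
      ≡⟨ N-suc n (three (suc i) (suc k) (suc l) (suc j)) ⟩
    a + preimages N′ (three (suc i) (suc k) (suc l) (suc j))
      ≡⟨ cong (a +_) (preimages-· N′ i k (true ∷ one (suc l) (suc j))) ⟩
    a + (x + b + a + N′ (i · true ∷ true ∷ k · true ∷ one (suc l) (suc j))
      + preimages (λ z → N′ (suc i · true ∷ z)) (two (suc k) (suc l) (suc j)))
      ≡⟨ cong₂ (λ u v → a + (x + b + a + u + v)) (N-bad (suc n) (bad-· i twin))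
           (preimages-· (λ z → N′ (suc i · true ∷ z)) k l (true ∷ suc j · [])) ⟩
    a + (x + b + a + 0 + (y + c + b + N′ (suc i · true ∷ k · true ∷ true ∷ one l (suc j))
      + preimages (λ z → N′ (suc i · true ∷ suc k · true ∷ z)) (one (suc l) (suc j))))
      ≡⟨ cong₂ (λ u v → a + (x + b + a + 0 + (y + c + b + u + v)))
           (N-bad (suc n) (bad-· (suc i) (later (bad-· k twin))))
           (preimages-· (λ z → N′ (suc i · true ∷ suc k · true ∷ z)) l j []) ⟩
    a + (x + b + a + 0 + (y + c + b + 0 + (w + d + c + N′ (suc i · true ∷ suc k · true ∷ l · true ∷ true ∷ j · [])
      + preimages (λ z → N′ (suc i · true ∷ suc k · true ∷ suc l · true ∷ z)) (suc j · []))))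
      ≡⟨ cong₂ (λ u v → a + (x + b + a + 0 + (y + c + b + 0 + (w + d + c + u + v))))
           (N-bad (suc n) (bad-· (suc i) (later (bad-· (suc k) (later (bad-· l twin))))))
           (preimages-end (λ z → N′ (suc i · true ∷ suc k · true ∷ suc l · true ∷ z)) j) ⟩
    a + (x + b + a + 0 + (y + c + b + 0 + (w + d + c + 0 + d)))
      ≡⟨ solve 7 (λ a b c d x y w →
             a :+ (x :+ b :+ a :+ con 0 :+ (y :+ c :+ b :+ con 0 :+ (w :+ d :+ c :+ con 0 :+ d)))
             := x :+ y :+ w :+ con 2 :* a :+ con 2 :* b :+ con 2 :* c :+ con 2 :* d) refl a b c d x y w ⟩
    x + y + w + 2 * a + 2 * b + 2 * c + 2 * d ∎
    where
    open ℕ-Solver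
    N′ = N (suc n)
    a = N′ (three i (suc k) (suc l) (suc j))
    b = N′ (three (suc i) k (suc l) (suc j))
    c = N′ (three (suc i) (suc k) l (suc j))
    d = N′ (three (suc i) (suc k) (suc l) j)
    x = N′ (two (2 + i + k) (suc l) (suc j))
    y = N′ (two (suc i) (2 + k + l) (suc j))
    w = N′ (two (suc i) (suc k) (2 + l + j))

module ClosedForm where

  open Insertion
  import Data.Nat as ℕ
  import Data.Nat.Properties as ℕ
  import Data.Integer as ℤ
  import Data.Integer.Properties as ℤ
  open import Data.Integer using (ℤ; +_; _+_; _*_; _-_; -_)

  -- The binomial coefficient (p + q) choose p.
  binom : ℕ → ℕ → ℕ
  binom zero    q       = 1
  binom (suc p) zero    = 1
  binom (suc p) (suc q) = binom p (suc q) ℕ.+ binom (suc p) q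

  binom-sym : ∀ p q → binom p q ≡ binom q p
  binom-sym zero    zero    = refl
  binom-sym zero    (suc q) = refl
  binom-sym (suc p) zero    = refl
  binom-sym (suc p) (suc q) = trans (cong₂ ℕ._+_ (binom-sym p (suc q)) (binom-sym (suc p) q))
                                    (ℕ.+-comm (binom (suc q) p) (binom q (suc p)))

  binom-zeroʳ : ∀ p → binom p 0 ≡ 1
  binom-zeroʳ zero    = refl
  binom-zeroʳ (suc p) = refl

  binom-oneˡ : ∀ q → binom 1 q ≡ suc q
  binom-oneˡ zero    = refl
  binom-oneˡ (suc q) = cong suc (binom-oneˡ q)

  binom-oneʳ : ∀ p → binom p 1 ≡ suc p
  binom-oneʳ p = trans (binom-sym p 1) (binom-oneˡ p)

  2^-suc : ∀ n → + (2 ^ suc n) ≡ + 2 * + (2 ^ n)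
  2^-suc n = ℤ.pos-* 2 (2 ^ n)

  -- Closed forms for zero to three peaks

  N-zero : ∀ n → N (suc n) (suc n · []) ≡ 2 ^ n
  N-zero zero    = refl
  N-zero (suc n) = trans (N-zero-suc n (suc n)) (cong (2 ℕ.*_) (N-zero n))

  -- On both axes the count is zero and the binomial coefficient is 1. Inside, the source
  -- contributes +1 after division by the power of 2, which turns the two corrections -1 of Pascal's
  -- rule back into one.
  N-one : ∀ n i j → suc n ≡ i ℕ.+ j →
    + N (2 ℕ.+ n) (one i j) ≡ + (2 ^ n) * (+ binom i j - + 1)
  N-one n zero j _ = trans (cong +_ (N-first (2 ℕ.+ n) _)) (sym (ℤ.*-zeroʳ (+ (2 ^ n))))
  N-one n (suc i) zero _ = trans (cong +_ (N-bad (2 ℕ.+ n) (bad-· (suc i) last))) (sym (ℤ.*-zeroʳ (+ (2 ^ n))))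
  N-one zero (suc i) (suc j) eq with () ← trans (ℕ.suc-injective eq) (ℕ.+-suc i j)
  N-one (suc n) (suc i) (suc j) eq = begin
    + N (3 ℕ.+ n) (one (suc i) (suc j))
      ≡⟨ cong +_ (N-one-suc (suc n) i j) ⟩
    + a + + (2 ℕ.* b) + + (2 ℕ.* c)
      ≡⟨ cong₂ (λ x y → + a + x + y) (ℤ.pos-* 2 b) (ℤ.pos-* 2 c) ⟩
    + a + + 2 * + b + + 2 * + c
      ≡⟨ cong₂ (λ x y → + a + + 2 * x + + 2 * y) (N-one n i (suc j) eq₁) (N-one n (suc i) j eq₂) ⟩
    + a + + 2 * (p * (+ x - + 1)) + + 2 * (p * (+ y - + 1))
      ≡⟨ cong (λ a → a + + 2 * (p * (+ x - + 1)) + + 2 * (p * (+ y - + 1))) a≡ ⟩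
    + 2 * p + + 2 * (p * (+ x - + 1)) + + 2 * (p * (+ y - + 1))
      ≡⟨ solve 3 (λ p x y → con (+ 2) :* p :+ con (+ 2) :* (p :* (x :- con (+ 1))) :+ con (+ 2) :* (p :* (y :- con (+ 1)))
                    := (con (+ 2) :* p) :* (x :+ y :- con (+ 1))) refl p (+ x) (+ y) ⟩
    + 2 * p * (+ x + + y - + 1)
      ≡⟨ cong (_* (+ x + + y - + 1)) (sym (2^-suc n)) ⟩
    + (2 ^ suc n) * (+ binom (suc i) (suc j) - + 1) ∎
    where
    open ℤ-Solver
    a = N (2 ℕ.+ n) ((2 ℕ.+ i ℕ.+ j) · [])
    b = N (2 ℕ.+ n) (one i (suc j))
    c = N (2 ℕ.+ n) (one (suc i) j)
    x = binom i (suc j)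
    y = binom (suc i) j
    p = + (2 ^ n)
    eq₁ : suc n ≡ i ℕ.+ suc j
    eq₁ = ℕ.suc-injective eq
    eq₂ : suc n ≡ suc i ℕ.+ j
    eq₂ = trans eq₁ (ℕ.+-suc i j)
    a≡ : + a ≡ + 2 * p
    a≡ = trans (cong +_ (trans (cong (λ m → N (2 ℕ.+ n) (suc m · [])) (sym eq₂)) (N-zero (suc n)))) (2^-suc n)

  -- #P({2,m};n) / 2^(n-3) for k = m-3 and j = n-m.
  d : ℕ → ℕ → ℤ
  d k j = + k * + binom (2 ℕ.+ k) j + + binom (suc k) j - + (suc k ℕ.+ j)

  -- Both {2,m} and, read backwards, {m,n-1} lead to this recurrence.
  d-unique : (X : ℕ → ℕ → ℕ → ℤ) →
    (∀ n j → X n 0 j ≡ + 0) → (∀ n k → X n k 0 ≡ + 0) →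
    (∀ n k j → n ≡ k ℕ.+ j → X (2 ℕ.+ n) (suc k) (suc j) ≡
       + (2 ^ (2 ℕ.+ n)) * (+ binom (2 ℕ.+ k) (suc j) + + (suc k ℕ.+ j))
       + + 2 * X (suc n) k (suc j) + + 2 * X (suc n) (suc k) j) →
    ∀ n k j → n ≡ k ℕ.+ j → X n k j ≡ + (2 ^ n) * d k j
  d-unique X X₀ X₁ Xₛ n zero j eq = trans (X₀ n j) (sym (trans
    (cong (λ b → + (2 ^ n) * (+ 0 + + b - + suc j)) (binom-oneˡ j))
    (trans (cong (+ (2 ^ n) *_) (ℤ.+-inverseʳ (+ suc j))) (ℤ.*-zeroʳ (+ (2 ^ n))))))
  d-unique X X₀ X₁ Xₛ n (suc k) zero eq = trans (X₁ n (suc k)) (sym (begin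
    + (2 ^ n) * (+ suc k * + 1 + + 1 - + (2 ℕ.+ k ℕ.+ 0))
      ≡⟨ cong (λ m → + (2 ^ n) * (+ suc k * + 1 + + 1 - + (2 ℕ.+ m))) (ℕ.+-identityʳ k) ⟩
    + (2 ^ n) * (+ suc k * + 1 + + 1 - + (2 ℕ.+ k))
      ≡⟨ solve 2 (λ p k → p :* ((con (+ 1) :+ k) :* con (+ 1) :+ con (+ 1) :- (con (+ 2) :+ k)) := con (+ 0)) refl (+ (2 ^ n)) (+ k) ⟩
    + 0 ∎))
    where open ℤ-Solver
  d-unique X X₀ X₁ Xₛ zero (suc k) (suc j) ()
  d-unique X X₀ X₁ Xₛ (suc zero) (suc k) (suc j) eq with () ← trans (ℕ.suc-injective eq) (ℕ.+-suc k j)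
  d-unique X X₀ X₁ Xₛ (suc (suc n)) (suc k) (suc j) eq = begin
    X (2 ℕ.+ n) (suc k) (suc j)
      ≡⟨ Xₛ n k j (ℕ.suc-injective eq₂) ⟩
    + (2 ^ (2 ℕ.+ n)) * (+ (x ℕ.+ y) + + (suc k ℕ.+ j)) + + 2 * X (suc n) k (suc j) + + 2 * X (suc n) (suc k) j
      ≡⟨ cong₂ (λ u v → + (2 ^ (2 ℕ.+ n)) * (+ (x ℕ.+ y) + + (suc k ℕ.+ j)) + + 2 * u + + 2 * v)
           (d-unique X X₀ X₁ Xₛ (suc n) k (suc j) eq₁) (d-unique X X₀ X₁ Xₛ (suc n) (suc k) j eq₂) ⟩
    + (2 ^ (2 ℕ.+ n)) * (+ (x ℕ.+ y) + + (suc k ℕ.+ j))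
      + + 2 * (p * (+ k * + (x ℕ.+ y) + + x - + (suc k ℕ.+ suc j))) + + 2 * (p * (+ suc k * + v + + y - + (2 ℕ.+ k ℕ.+ j)))
      ≡⟨ cong₂ (λ q m → q * (+ (x ℕ.+ y) + + (suc k ℕ.+ j))
           + + 2 * (p * (+ k * + (x ℕ.+ y) + + x - + suc m)) + + 2 * (p * (+ suc k * + v + + y - + (2 ℕ.+ k ℕ.+ j))))
           (2^-suc (suc n)) (ℕ.+-suc k j) ⟩
    + 2 * p * (+ x + + y + (+ 1 + + k + + j))
      + + 2 * (p * (+ k * (+ x + + y) + + x - (+ 2 + + k + + j)))
      + + 2 * (p * ((+ 1 + + k) * + v + + y - (+ 2 + + k + + j)))
      ≡⟨ solve 6 (λ p k j x y v →
           con (+ 2) :* p :* (x :+ y :+ (con (+ 1) :+ k :+ j))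
           :+ con (+ 2) :* (p :* (k :* (x :+ y) :+ x :- (con (+ 2) :+ k :+ j)))
           :+ con (+ 2) :* (p :* ((con (+ 1) :+ k) :* v :+ y :- (con (+ 2) :+ k :+ j)))
           := con (+ 2) :* p :* ((con (+ 1) :+ k) :* (x :+ y :+ v) :+ (x :+ y) :- (con (+ 3) :+ k :+ j)))
           refl p (+ k) (+ j) (+ x) (+ y) (+ v) ⟩
    + 2 * p * (+ suc k * + binom (3 ℕ.+ k) (suc j) + + binom (2 ℕ.+ k) (suc j) - + (3 ℕ.+ k ℕ.+ j))
      ≡⟨ cong₂ (λ q m → q * (+ suc k * + binom (3 ℕ.+ k) (suc j) + + binom (2 ℕ.+ k) (suc j) - + (2 ℕ.+ m)))
           (sym (2^-suc (suc n))) (sym (ℕ.+-suc k j)) ⟩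
    + (2 ^ (2 ℕ.+ n)) * d (suc k) (suc j) ∎
    where
    open ℤ-Solver
    p = + (2 ^ suc n)
    x = binom (suc k) (suc j)
    y = binom (2 ℕ.+ k) j
    v = binom (3 ℕ.+ k) j
    eq₁ : suc n ≡ k ℕ.+ suc j
    eq₁ = ℕ.suc-injective eq
    eq₂ : suc n ≡ suc k ℕ.+ j
    eq₂ = trans eq₁ (ℕ.+-suc k j)

  -- Shortening the first run, of length 1, would put a peak on the first letter, so that term drops
  -- out. Erasing either peak leaves a one-peak word; the two counts from `N-one` make up the source
  -- term.
  N-two-left : ∀ n k j → n ≡ k ℕ.+ j → + N (3 ℕ.+ n) (two 1 k j) ≡ + (2 ^ n) * d k j
  N-two-left = d-unique (λ n k j → + N (3 ℕ.+ n) (two 1 k j))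
    (λ n j → cong +_ (N-bad (3 ℕ.+ n) (later twin)))
    (λ n k → cong +_ (N-bad (3 ℕ.+ n) (later (later (bad-· k last)))))
    step
    where
    open ℤ-Solver
    step : ∀ n k j → n ≡ k ℕ.+ j → + N (5 ℕ.+ n) (two 1 (suc k) (suc j)) ≡
       + (2 ^ (2 ℕ.+ n)) * (+ binom (2 ℕ.+ k) (suc j) + + (suc k ℕ.+ j))
       + + 2 * + N (4 ℕ.+ n) (two 1 k (suc j)) + + 2 * + N (4 ℕ.+ n) (two 1 (suc k) j)
    step n k j eq = begin
      + N (5 ℕ.+ n) (two 1 (suc k) (suc j))
        ≡⟨ cong +_ (N-two-suc (3 ℕ.+ n) 0 k j) ⟩
      + x + + y + + (2 ℕ.* z) + + (2 ℕ.* b) + + (2 ℕ.* c)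
        ≡⟨ cong₂ (λ u v → + x + + y + + (2 ℕ.* z) + u + v) (ℤ.pos-* 2 b) (ℤ.pos-* 2 c) ⟩
      + x + + y + + (2 ℕ.* z) + + 2 * + b + + 2 * + c
        ≡⟨ cong (λ z → + x + + y + + (2 ℕ.* z) + + 2 * + b + + 2 * + c) (N-first (4 ℕ.+ n) _) ⟩
      + x + + y + + 0 + + 2 * + b + + 2 * + c
        ≡⟨ cong₂ (λ u v → u + v + + 0 + + 2 * + b + + 2 * + c)
             (N-one (2 ℕ.+ n) (2 ℕ.+ k) (suc j) (cong (2 ℕ.+_) (trans (cong suc eq) (sym (ℕ.+-suc k j)))))
             (trans (N-one (2 ℕ.+ n) 1 (2 ℕ.+ k ℕ.+ j) (cong (3 ℕ.+_) eq))
                    (cong (λ b → p * (+ b - + 1)) (binom-oneˡ (2 ℕ.+ k ℕ.+ j)))) ⟩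
      p * (+ t - + 1) + p * (+ (3 ℕ.+ k ℕ.+ j) - + 1) + + 0 + + 2 * + b + + 2 * + c
        ≡⟨ solve 5 (λ p t m b c → p :* (t :- con (+ 1)) :+ p :* (con (+ 2) :+ m :- con (+ 1)) :+ con (+ 0) :+ con (+ 2) :* b :+ con (+ 2) :* c
               := p :* (t :+ m) :+ con (+ 2) :* b :+ con (+ 2) :* c) refl p (+ t) (+ (suc k ℕ.+ j)) (+ b) (+ c) ⟩
      p * (+ t + + (suc k ℕ.+ j)) + + 2 * + b + + 2 * + c ∎
      where
      p = + (2 ^ (2 ℕ.+ n))
      t = binom (2 ℕ.+ k) (suc j)
      x = N (4 ℕ.+ n) (one (2 ℕ.+ k) (suc j))
      y = N (4 ℕ.+ n) (one 1 (2 ℕ.+ k ℕ.+ j))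
      z = N (4 ℕ.+ n) (two 0 (suc k) (suc j))
      b = N (4 ℕ.+ n) (two 1 k (suc j))
      c = N (4 ℕ.+ n) (two 1 (suc k) j)

  -- The mirror image of `N-two-left`, read off from the same recurrence instead of from reversal of
  -- permutations: now the last run has length 1, and its shortening vanishes because no word ends
  -- in a peak.
  N-two-right : ∀ n k j → n ≡ k ℕ.+ j → + N (3 ℕ.+ n) (two j k 1) ≡ + (2 ^ n) * d k j
  N-two-right = d-unique (λ n k j → + N (3 ℕ.+ n) (two j k 1))
    (λ n j → cong +_ (N-bad (3 ℕ.+ n) (bad-· j twin)))
    (λ n k → cong +_ (N-first (3 ℕ.+ n) _))
    step
    where
    open ℤ-Solver
    step : ∀ n k j → n ≡ k ℕ.+ j → + N (5 ℕ.+ n) (two (suc j) (suc k) 1) ≡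
       + (2 ^ (2 ℕ.+ n)) * (+ binom (2 ℕ.+ k) (suc j) + + (suc k ℕ.+ j))
       + + 2 * + N (4 ℕ.+ n) (two (suc j) k 1) + + 2 * + N (4 ℕ.+ n) (two j (suc k) 1)
    step n k j eq = begin
      + N (5 ℕ.+ n) (two (suc j) (suc k) 1)
        ≡⟨ cong +_ (N-two-suc (3 ℕ.+ n) j k 0) ⟩
      + x + + y + + (2 ℕ.* c) + + (2 ℕ.* b) + + (2 ℕ.* z)
        ≡⟨ cong₂ (λ u v → + x + + y + u + v + + (2 ℕ.* z)) (ℤ.pos-* 2 c) (ℤ.pos-* 2 b) ⟩
      + x + + y + + 2 * + c + + 2 * + b + + (2 ℕ.* z)
        ≡⟨ cong (λ z → + x + + y + + 2 * + c + + 2 * + b + + (2 ℕ.* z))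
             (N-bad (4 ℕ.+ n) (bad-· (suc j) (later (bad-· (suc k) last)))) ⟩
      + x + + y + + 2 * + c + + 2 * + b + + 0
        ≡⟨ cong₂ (λ u v → u + v + + 2 * + c + + 2 * + b + + 0)
             (trans (N-one (2 ℕ.+ n) (2 ℕ.+ j ℕ.+ k) 1 (trans (cong (3 ℕ.+_) (trans eq (ℕ.+-comm k j))) (ℕ.+-comm 1 (2 ℕ.+ j ℕ.+ k))))
                    (cong (λ b → p * (+ b - + 1)) (trans (binom-oneʳ (2 ℕ.+ j ℕ.+ k)) (cong (3 ℕ.+_) (ℕ.+-comm j k)))))
             (trans (cong (λ m → + N (4 ℕ.+ n) (one (suc j) (2 ℕ.+ m))) (ℕ.+-identityʳ k))
               (trans (N-one (2 ℕ.+ n) (suc j) (2 ℕ.+ k) (trans (cong (2 ℕ.+_) (trans (cong suc eq) (sym (ℕ.+-suc k j)))) (ℕ.+-comm (2 ℕ.+ k) (suc j))))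
                      (cong (λ b → p * (+ b - + 1)) (binom-sym (suc j) (2 ℕ.+ k))))) ⟩
      p * (+ (3 ℕ.+ k ℕ.+ j) - + 1) + p * (+ t - + 1) + + 2 * + c + + 2 * + b + + 0
        ≡⟨ solve 5 (λ p t m b c → p :* (con (+ 2) :+ m :- con (+ 1)) :+ p :* (t :- con (+ 1)) :+ con (+ 2) :* c :+ con (+ 2) :* b :+ con (+ 0)
               := p :* (t :+ m) :+ con (+ 2) :* b :+ con (+ 2) :* c) refl p (+ t) (+ (suc k ℕ.+ j)) (+ b) (+ c) ⟩
      p * (+ t + + (suc k ℕ.+ j)) + + 2 * + b + + 2 * + c ∎
      where
      p = + (2 ^ (2 ℕ.+ n))
      t = binom (2 ℕ.+ k) (suc j)
      x = N (4 ℕ.+ n) (one (2 ℕ.+ j ℕ.+ k) 1)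
      y = N (4 ℕ.+ n) (one (suc j) (2 ℕ.+ k ℕ.+ 0))
      z = N (4 ℕ.+ n) (two (suc j) (suc k) 0)
      b = N (4 ℕ.+ n) (two (suc j) k 1)
      c = N (4 ℕ.+ n) (two j (suc k) 1)

  -- p({2,m,n-1};n) for P = m-3 and Q = n-m-2.
  e : ℕ → ℕ → ℤ
  e P Q = + P * + Q * + binom (2 ℕ.+ P) (2 ℕ.+ Q) + + 2 * (+ P + + Q + + 4) * + binom (suc P) (suc Q)
          - + 2 * + binom (2 ℕ.+ P) (2 ℕ.+ Q) - (+ P + + Q + + 4) * (+ P + + Q + + 1)

  binom-two : ∀ q → 2 ℕ.* binom 2 q ≡ suc q ℕ.* (2 ℕ.+ q)
  binom-two zero    = refl
  binom-two (suc q) = begin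
    2 ℕ.* (binom 1 (suc q) ℕ.+ binom 2 q)       ≡⟨ ℕ.*-distribˡ-+ 2 (binom 1 (suc q)) (binom 2 q) ⟩
    2 ℕ.* binom 1 (suc q) ℕ.+ 2 ℕ.* binom 2 q   ≡⟨ cong₂ (λ x y → 2 ℕ.* x ℕ.+ y) (binom-oneˡ (suc q)) (binom-two q) ⟩
    2 ℕ.* (2 ℕ.+ q) ℕ.+ suc q ℕ.* (2 ℕ.+ q)
      ≡⟨ solve 1 (λ q → con 2 :* (con 2 :+ q) :+ (con 1 :+ q) :* (con 2 :+ q) := (con 2 :+ q) :* (con 3 :+ q)) refl q ⟩
    (2 ℕ.+ q) ℕ.* (3 ℕ.+ q) ∎
    where open ℕ-Solver

  e-sym : ∀ P Q → e P Q ≡ e Q P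
  e-sym P Q rewrite binom-sym (2 ℕ.+ P) (2 ℕ.+ Q) | binom-sym (suc P) (suc Q) =
    solve 4 (λ P Q x y →
        P :* Q :* x :+ con (+ 2) :* (P :+ Q :+ con (+ 4)) :* y :- con (+ 2) :* x :- (P :+ Q :+ con (+ 4)) :* (P :+ Q :+ con (+ 1))
        := Q :* P :* x :+ con (+ 2) :* (Q :+ P :+ con (+ 4)) :* y :- con (+ 2) :* x :- (Q :+ P :+ con (+ 4)) :* (Q :+ P :+ con (+ 1)))
      refl (+ P) (+ Q) (+ binom (2 ℕ.+ Q) (2 ℕ.+ P)) (+ binom (suc Q) (suc P))
    where open ℤ-Solver

  -- For `P = 0` the peaks 2 and 3 would be adjacent, so the closed form has to vanish; the
  -- correction (n-1)(n-4) is exactly what the other terms leave over.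
  e-zeroˡ : ∀ Q → e 0 Q ≡ + 0
  e-zeroˡ Q = begin
    + 0 * + Q * x + + 2 * (+ 0 + + Q + + 4) * + binom 1 (suc Q) - + 2 * x - (+ 0 + + Q + + 4) * (+ 0 + + Q + + 1)
      ≡⟨ cong₂ (λ y z → + 0 * + Q * x + + 2 * (+ 0 + + Q + + 4) * + y - z - (+ 0 + + Q + + 4) * (+ 0 + + Q + + 1))
           (binom-oneˡ (suc Q))
           (trans (sym (ℤ.pos-* 2 (binom 2 (2 ℕ.+ Q)))) (trans (cong +_ (binom-two (2 ℕ.+ Q))) (ℤ.pos-* (3 ℕ.+ Q) (4 ℕ.+ Q)))) ⟩
    + 0 * + Q * x + + 2 * (+ 0 + + Q + + 4) * (+ 2 + + Q) - (+ 3 + + Q) * (+ 4 + + Q) - (+ 0 + + Q + + 4) * (+ 0 + + Q + + 1)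
      ≡⟨ solve 2 (λ Q x →
           con (+ 0) :* Q :* x :+ con (+ 2) :* (con (+ 0) :+ Q :+ con (+ 4)) :* (con (+ 2) :+ Q) :- (con (+ 3) :+ Q) :* (con (+ 4) :+ Q)
             :- (con (+ 0) :+ Q :+ con (+ 4)) :* (con (+ 0) :+ Q :+ con (+ 1)) := con (+ 0)) refl (+ Q) x ⟩
    + 0 ∎
    where
    open ℤ-Solver
    x = + binom 2 (2 ℕ.+ Q)

  +-split : ∀ a b p q → a ℕ.+ b ℕ.+ (p ℕ.+ q) ≡ a ℕ.+ p ℕ.+ (b ℕ.+ q)
  +-split = solve 4 (λ a b p q → a :+ b :+ (p :+ q) := a :+ p :+ (b :+ q)) refl
    where open ℕ-Solver

  -- Erasing the first, middle or last peak leaves {m,n-1}, {2,n-1} or {2,m} in a shorter word: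
  -- these are the sources `X`, `Y`, `W`. The terms `a` and `f`, which shorten an outer run to
  -- length 0, vanish.
  N-three : ∀ n P Q → n ≡ P ℕ.+ Q → + N (5 ℕ.+ n) (three 1 P Q 1) ≡ + (2 ^ suc n) * e P Q
  N-three n zero Q _ = trans (cong +_ (N-bad (5 ℕ.+ n) (later twin)))
    (sym (trans (cong (+ (2 ^ suc n) *_) (e-zeroˡ Q)) (ℤ.*-zeroʳ (+ (2 ^ suc n)))))
  N-three n (suc P) zero _ = trans (cong +_ (N-bad (5 ℕ.+ n) (later (later (bad-· (suc P) twin)))))
    (sym (trans (cong (+ (2 ^ suc n) *_) (trans (e-sym (suc P) 0) (e-zeroˡ (suc P)))) (ℤ.*-zeroʳ (+ (2 ^ suc n)))))
  N-three (suc zero) (suc P) (suc Q) eq with () ← trans (ℕ.suc-injective eq) (ℕ.+-suc P Q)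
  N-three (suc (suc n)) (suc P) (suc Q) eq = begin
    + N (7 ℕ.+ n) (three 1 (suc P) (suc Q) 1)
      ≡⟨ cong +_ (N-three-suc (5 ℕ.+ n) 0 P Q 0) ⟩
    + X + + Y + + W + + (2 ℕ.* a) + + (2 ℕ.* b) + + (2 ℕ.* c) + + (2 ℕ.* f)
      ≡⟨ cong₂ (λ a f → + X + + Y + + W + + (2 ℕ.* a) + + (2 ℕ.* b) + + (2 ℕ.* c) + + (2 ℕ.* f))
           (N-first (6 ℕ.+ n) _)
           (N-bad (6 ℕ.+ n) (later (later (bad-· (suc P) (later (bad-· (suc Q) last)))))) ⟩
    + X + + Y + + W + + 0 + + (2 ℕ.* b) + + (2 ℕ.* c) + + 0
      ≡⟨ cong₂ (λ b c → + X + + Y + + W + + 0 + b + c + + 0)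
           (trans (ℤ.pos-* 2 b) (cong (+ 2 *_) (N-three (suc n) P (suc Q) eq₁)))
           (trans (ℤ.pos-* 2 c) (cong (+ 2 *_) (N-three (suc n) (suc P) Q eq₂))) ⟩
    + X + + Y + + W + + 0 + + 2 * (p * e P (suc Q)) + + 2 * (p * e (suc P) Q) + + 0
      ≡⟨ cong₂ (λ X W → X + + Y + W + + 0 + + 2 * (p * e P (suc Q)) + + 2 * (p * e (suc P) Q) + + 0) X≡ W≡ ⟩
    + 2 * p * dX + + Y + + 2 * p * dW + + 0 + + 2 * (p * e P (suc Q)) + + 2 * (p * e (suc P) Q) + + 0
      ≡⟨ cong (λ Y → + 2 * p * dX + Y + + 2 * p * dW + + 0 + + 2 * (p * e P (suc Q)) + + 2 * (p * e (suc P) Q) + + 0) Y≡ ⟩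
    + 2 * p * dX + + 2 * p * dY + + 2 * p * dW + + 0 + + 2 * (p * e P (suc Q)) + + 2 * (p * e (suc P) Q) + + 0
      ≡⟨ solve 7 (λ p P Q s t v w →
           -- Both polynomials are n-1 for the shorter words, associated as they appear in
           -- `e P (suc Q)` and `e (suc P) Q`.
           let M = P :+ (k 1 :+ Q) :+ k 4 ; M′ = (k 1 :+ P) :+ Q :+ k 4 in
           k 2 :* p :* ((k 1 :+ Q) :* s :+ (v :+ w) :- (P :+ Q :+ k 4))
           :+ k 2 :* p :* ((P :+ Q :+ k 2) :* (P :+ Q :+ k 5))
           :+ k 2 :* p :* ((k 1 :+ P) :* t :+ (v :+ w) :- (P :+ Q :+ k 4))
           :+ k 0
           :+ k 2 :* (p :* (P :* (k 1 :+ Q) :* s :+ k 2 :* M :* v :- k 2 :* s :- M :* (P :+ (k 1 :+ Q) :+ k 1)))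
           :+ k 2 :* (p :* ((k 1 :+ P) :* Q :* t :+ k 2 :* M′ :* w :- k 2 :* t :- M′ :* ((k 1 :+ P) :+ Q :+ k 1)))
           :+ k 0
           := k 2 :* p :* ((k 1 :+ P) :* (k 1 :+ Q) :* (s :+ t) :+ k 2 :* ((k 1 :+ P) :+ (k 1 :+ Q) :+ k 4) :* (v :+ w)
                :- k 2 :* (s :+ t) :- ((k 1 :+ P) :+ (k 1 :+ Q) :+ k 4) :* ((k 1 :+ P) :+ (k 1 :+ Q) :+ k 1)))
           refl p (+ P) (+ Q) (+ s) (+ t) (+ v) (+ w) ⟩
    + 2 * p * e (suc P) (suc Q)
      ≡⟨ cong (_* e (suc P) (suc Q)) (sym (2^-suc (2 ℕ.+ n))) ⟩
    + (2 ^ (3 ℕ.+ n)) * e (suc P) (suc Q) ∎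
    where
    open ℤ-Solver
    k : ∀ {m} → ℕ → Polynomial m
    k i = con (+ i)
    p = + (2 ^ (2 ℕ.+ n))
    s = binom (2 ℕ.+ P) (3 ℕ.+ Q)
    t = binom (3 ℕ.+ P) (2 ℕ.+ Q)
    v = binom (suc P) (2 ℕ.+ Q)
    w = binom (2 ℕ.+ P) (suc Q)
    a = N (6 ℕ.+ n) (three 0 (suc P) (suc Q) 1)
    b = N (6 ℕ.+ n) (three 1 P (suc Q) 1)
    c = N (6 ℕ.+ n) (three 1 (suc P) Q 1)
    f = N (6 ℕ.+ n) (three 1 (suc P) (suc Q) 0)
    X = N (6 ℕ.+ n) (two (2 ℕ.+ P) (suc Q) 1)
    Y = N (6 ℕ.+ n) (two 1 (2 ℕ.+ P ℕ.+ Q) 1)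
    W = N (6 ℕ.+ n) (two 1 (suc P) (2 ℕ.+ Q ℕ.+ 0))
    dX = (+ 1 + + Q) * + s + (+ v + + w) - (+ P + + Q + + 4)
    dY = (+ P + + Q + + 2) * (+ P + + Q + + 5)
    dW = (+ 1 + + P) * + t + (+ v + + w) - (+ P + + Q + + 4)
    eq₁ : suc n ≡ P ℕ.+ suc Q
    eq₁ = ℕ.suc-injective eq
    eq₂ : suc n ≡ suc P ℕ.+ Q
    eq₂ = trans eq₁ (ℕ.+-suc P Q)
    eq₃ : n ≡ P ℕ.+ Q
    eq₃ = ℕ.suc-injective eq₂

    p≡ : + (2 ^ (3 ℕ.+ n)) ≡ + 2 * p
    p≡ = 2^-suc (2 ℕ.+ n)

    X≡ : + X ≡ + 2 * p * dX
    X≡ = trans (N-two-right (3 ℕ.+ n) (suc Q) (2 ℕ.+ P) (trans (cong (3 ℕ.+_) eq₃)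
                 (trans (cong (3 ℕ.+_) (ℕ.+-comm P Q)) (+-split 1 2 Q P))))
         (cong₂ _*_ p≡ (trans
           (cong₂ (λ x y → + suc Q * + x + + y - + (2 ℕ.+ Q ℕ.+ (2 ℕ.+ P)))
             (binom-sym (3 ℕ.+ Q) (2 ℕ.+ P)) (binom-sym (2 ℕ.+ Q) (2 ℕ.+ P)))
           (solve 4 (λ P Q s u → (con (+ 1) :+ Q) :* s :+ u :- (con (+ 2) :+ Q :+ (con (+ 2) :+ P))
                       := (con (+ 1) :+ Q) :* s :+ u :- (P :+ Q :+ con (+ 4))) refl (+ P) (+ Q) (+ s) (+ v + + w))))

    W≡ : + W ≡ + 2 * p * dW
    W≡ = trans (cong (λ m → + N (6 ℕ.+ n) (two 1 (suc P) (2 ℕ.+ m))) (ℕ.+-identityʳ Q))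
         (trans (N-two-left (3 ℕ.+ n) (suc P) (2 ℕ.+ Q) (trans (cong (3 ℕ.+_) eq₃)
                 (+-split 1 2 P Q)))
         (cong₂ _*_ p≡
           (solve 4 (λ P Q t u → (con (+ 1) :+ P) :* t :+ u :- (con (+ 2) :+ P :+ (con (+ 2) :+ Q))
                       := (con (+ 1) :+ P) :* t :+ u :- (P :+ Q :+ con (+ 4))) refl (+ P) (+ Q) (+ t) (+ v + + w))))

    Y≡ : + Y ≡ + 2 * p * dY
    Y≡ = trans (N-two-left (3 ℕ.+ n) (2 ℕ.+ P ℕ.+ Q) 1 (trans (cong (3 ℕ.+_) eq₃) (ℕ.+-comm 1 (2 ℕ.+ P ℕ.+ Q))))
         (cong₂ _*_ p≡ (trans
           (cong₂ (λ x y → + (2 ℕ.+ P ℕ.+ Q) * + x + + y - + (3 ℕ.+ P ℕ.+ Q ℕ.+ 1))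
             (binom-oneʳ (4 ℕ.+ P ℕ.+ Q)) (binom-oneʳ (3 ℕ.+ P ℕ.+ Q)))
           (solve 2 (λ P Q → (con (+ 2) :+ P :+ Q) :* (con (+ 5) :+ P :+ Q) :+ (con (+ 4) :+ P :+ Q) :- (con (+ 3) :+ P :+ Q :+ con (+ 1))
                       := (P :+ Q :+ con (+ 2)) :* (P :+ Q :+ con (+ 5))) refl (+ P) (+ Q))))

  -- From run lengths back to peak sets

  positions-· : ∀ i k s → positions i (k · s) ≡ positions (k ℕ.+ i) s
  positions-· i zero    s = refl
  positions-· i (suc k) s = trans (positions-· (suc i) k s) (cong (λ m → positions m s) (ℕ.+-suc k i))

  length-· : ∀ k s → length (k · s) ≡ k ℕ.+ length s
  length-· zero    s = refl
  length-· (suc k) s = cong suc (length-· k s)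

  positions-three : ∀ P Q → positions 1 (three 1 P Q 1) ≡ 2 ∷ (P ℕ.+ 3) ∷ (Q ℕ.+ suc (P ℕ.+ 3)) ∷ []
  positions-three P Q = cong (2 ∷_) (trans (positions-· 3 P _)
    (cong ((P ℕ.+ 3) ∷_) (positions-· (suc (P ℕ.+ 3)) Q _)))

  length-three : ∀ P Q → length (three 1 P Q 1) ≡ 2 ℕ.+ (P ℕ.+ suc (Q ℕ.+ 2))
  length-three P Q = cong (2 ℕ.+_) (trans (length-· P _) (cong (λ m → P ℕ.+ suc m) (length-· Q _)))

  -- The gaps enter as `suc p` and `suc q`, hence the constants 4 and 7. Since `m` and `n` are given
  -- only up to equations, the same lemma serves for the mirrored index and for a second
  -- decomposition of the same `n`.
  count : ∀ m n p q → m ≡ 4 ℕ.+ p → n ≡ 7 ℕ.+ (p ℕ.+ q) →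
    + #P S[2, m , n -1] n ≡ + (2 ^ (n ∸ 4)) * e (suc p) (suc q)
  count _ _ p q refl refl = begin
    + #P (2 ∷ (4 ℕ.+ p) ∷ (6 ℕ.+ (p ℕ.+ q)) ∷ []) (7 ℕ.+ (p ℕ.+ q))
      ≡⟨ cong₂ (λ S n → + #P S n) S≡ n≡ ⟩
    + #P (positions 1 τ) (length τ)
      ≡⟨ cong +_ (#P-N τ) ⟩
    + N (length τ) τ
      ≡⟨ cong (λ n → + N n τ) (sym n≡) ⟩
    + N (7 ℕ.+ (p ℕ.+ q)) τ
      ≡⟨ N-three (2 ℕ.+ (p ℕ.+ q)) (suc p) (suc q) (cong suc (sym (ℕ.+-suc p q))) ⟩
    + (2 ^ (3 ℕ.+ (p ℕ.+ q))) * e (suc p) (suc q) ∎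
    where
    τ = three 1 (suc p) (suc q) 1
    S≡ : 2 ∷ (4 ℕ.+ p) ∷ (6 ℕ.+ (p ℕ.+ q)) ∷ [] ≡ positions 1 τ
    S≡ = sym (trans (positions-three (suc p) (suc q))
      (cong₂ (λ a b → 2 ∷ a ∷ b ∷ [])
        (solve 1 (λ p → con 1 :+ p :+ con 3 := con 4 :+ p) refl p)
        (solve 2 (λ p q → con 1 :+ q :+ (con 1 :+ (con 1 :+ p :+ con 3)) := con 6 :+ (p :+ q)) refl p q)))
      where open ℕ-Solver
    n≡ : 7 ℕ.+ (p ℕ.+ q) ≡ length τ
    n≡ = sym (trans (length-three (suc p) (suc q))
      (solve 2 (λ p q → con 2 :+ (con 1 :+ p :+ (con 1 :+ (con 1 :+ q :+ con 2))) := con 7 :+ (p :+ q)) refl p q))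
      where open ℕ-Solver

  -- Binomial identities and the stated formula

  C-binom : ∀ p q → (p ℕ.+ q) C p ≡ binom p q
  C-binom zero    q       = refl
  C-binom (suc p) zero    = trans (cong (_C suc p) (ℕ.+-identityʳ (suc p))) (nCn≡1 (suc p))
  C-binom (suc p) (suc q) = trans (sym (nCk+nC[k+1]≡[n+1]C[k+1] (p ℕ.+ suc q) p))
    (cong₂ ℕ._+_ (C-binom p (suc q)) (trans (cong (_C suc p) (ℕ.+-suc p q)) (C-binom (suc p) q)))

  C-split : ∀ a b p q → (a ℕ.+ b ℕ.+ (p ℕ.+ q)) C (a ℕ.+ p) ≡ binom (a ℕ.+ p) (b ℕ.+ q)
  C-split a b p q = trans (cong (_C (a ℕ.+ p)) (+-split a b p q)) (C-binom (a ℕ.+ p) (b ℕ.+ q))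

  -- Both sides are (p+q+1)!/(p! q!). In the induction both expansions contain multiples of the same
  -- coefficient `b`, with total factor p+q+3.
  binom-cross : ∀ p q → suc p ℕ.* binom (suc p) q ≡ suc q ℕ.* binom p (suc q)
  binom-cross zero    q       = trans (ℕ.*-identityˡ _) (trans (binom-oneˡ q) (sym (ℕ.*-identityʳ (suc q))))
  binom-cross (suc p) zero    = trans (ℕ.*-identityʳ (2 ℕ.+ p))
    (sym (trans (ℕ.*-identityˡ _) (binom-oneʳ (suc p))))
  binom-cross (suc p) (suc q) = begin
    (2 ℕ.+ p) ℕ.* (b ℕ.+ binom (2 ℕ.+ p) q)
      ≡⟨ ℕ.*-distribˡ-+ (2 ℕ.+ p) b _ ⟩
    (2 ℕ.+ p) ℕ.* b ℕ.+ (2 ℕ.+ p) ℕ.* binom (2 ℕ.+ p) q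
      ≡⟨ cong ((2 ℕ.+ p) ℕ.* b ℕ.+_) (binom-cross (suc p) q) ⟩
    (2 ℕ.+ p) ℕ.* b ℕ.+ suc q ℕ.* b
      ≡⟨ solve 3 (λ p q b → (con 2 :+ p) :* b :+ (con 1 :+ q) :* b := (con 1 :+ p) :* b :+ (con 2 :+ q) :* b) refl p q b ⟩
    suc p ℕ.* b ℕ.+ (2 ℕ.+ q) ℕ.* b
      ≡⟨ cong (ℕ._+ (2 ℕ.+ q) ℕ.* b) (binom-cross p (suc q)) ⟩
    (2 ℕ.+ q) ℕ.* binom p (2 ℕ.+ q) ℕ.+ (2 ℕ.+ q) ℕ.* b
      ≡⟨ sym (ℕ.*-distribˡ-+ (2 ℕ.+ q) (binom p (2 ℕ.+ q)) b) ⟩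
    (2 ℕ.+ q) ℕ.* (binom p (2 ℕ.+ q) ℕ.+ b) ∎
    where
    open ℕ-Solver
    b = binom (suc p) (suc q)

  binom-absorbˡ : ∀ p q → suc p ℕ.* binom (suc p) q ≡ suc (p ℕ.+ q) ℕ.* binom p q
  binom-absorbˡ p zero    = cong₂ ℕ._*_ (cong suc (sym (ℕ.+-identityʳ p))) (sym (binom-zeroʳ p))
  binom-absorbˡ p (suc q) = begin
    suc p ℕ.* (b ℕ.+ binom (suc p) q)           ≡⟨ ℕ.*-distribˡ-+ (suc p) b _ ⟩
    suc p ℕ.* b ℕ.+ suc p ℕ.* binom (suc p) q   ≡⟨ cong (suc p ℕ.* b ℕ.+_) (binom-cross p q) ⟩
    suc p ℕ.* b ℕ.+ suc q ℕ.* b                 ≡⟨ sym (ℕ.*-distribʳ-+ b (suc p) (suc q)) ⟩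
    suc (p ℕ.+ suc q) ℕ.* b ∎
    where b = binom p (suc q)

  binom-absorbʳ : ∀ p q → suc q ℕ.* binom p (suc q) ≡ suc (p ℕ.+ q) ℕ.* binom p q
  binom-absorbʳ p q = trans (sym (binom-cross p q)) (binom-absorbˡ p q)

  binom-absorb₂ : ∀ p q → suc p ℕ.* suc q ℕ.* binom (suc p) (suc q) ≡ (2 ℕ.+ (p ℕ.+ q)) ℕ.* suc (p ℕ.+ q) ℕ.* binom p q
  binom-absorb₂ p q = begin
    suc p ℕ.* suc q ℕ.* binom (suc p) (suc q)
      ≡⟨ solve 3 (λ a b c → a :* b :* c := b :* (a :* c)) refl (suc p) (suc q) (binom (suc p) (suc q)) ⟩
    suc q ℕ.* (suc p ℕ.* binom (suc p) (suc q))
      ≡⟨ cong (suc q ℕ.*_) (trans (binom-absorbˡ p (suc q)) (cong (λ m → suc m ℕ.* binom p (suc q)) (ℕ.+-suc p q))) ⟩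
    suc q ℕ.* ((2 ℕ.+ (p ℕ.+ q)) ℕ.* binom p (suc q))
      ≡⟨ solve 3 (λ a b c → a :* (b :* c) := b :* (a :* c)) refl (suc q) (2 ℕ.+ (p ℕ.+ q)) (binom p (suc q)) ⟩
    (2 ℕ.+ (p ℕ.+ q)) ℕ.* (suc q ℕ.* binom p (suc q))
      ≡⟨ cong ((2 ℕ.+ (p ℕ.+ q)) ℕ.*_) (binom-absorbʳ p q) ⟩
    (2 ℕ.+ (p ℕ.+ q)) ℕ.* (suc (p ℕ.+ q) ℕ.* binom p q)
      ≡⟨ sym (ℕ.*-assoc (2 ℕ.+ (p ℕ.+ q)) (suc (p ℕ.+ q)) (binom p q)) ⟩
    (2 ℕ.+ (p ℕ.+ q)) ℕ.* suc (p ℕ.+ q) ℕ.* binom p q ∎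
    where open ℕ-Solver

  pos-*-cong : ∀ a b c d → a ℕ.* b ≡ c ℕ.* d → + a * + b ≡ + c * + d
  pos-*-cong a b c d eq = trans (sym (ℤ.pos-* a b)) (trans (cong +_ eq) (ℤ.pos-* c d))

  rhs-binom : ∀ p q → rhs (4 ℕ.+ p) (7 ℕ.+ (p ℕ.+ q)) ≡
    + (suc p ℕ.* suc q ℕ.* binom (3 ℕ.+ p) (3 ℕ.+ q))
    + + (6 ℕ.+ (p ℕ.+ q)) * (+ (suc p ℕ.* binom (3 ℕ.+ p) q ℕ.+ (2 ℕ.+ p) ℕ.* binom (2 ℕ.+ p) (suc q)
        ℕ.+ (2 ℕ.+ q) ℕ.* binom (suc p) (2 ℕ.+ q) ℕ.+ suc q ℕ.* binom p (3 ℕ.+ q))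
       - + (2 ℕ.* (3 ℕ.+ (p ℕ.+ q))))
  rhs-binom p q = begin
    rhs (4 ℕ.+ p) (7 ℕ.+ (p ℕ.+ q))
      ≡⟨⟩
    R (3 ℕ.+ (p ℕ.+ q) ∸ p) (n+3 C (3 ℕ.+ p)) (n C (3 ℕ.+ p)) (n C (2 ℕ.+ p)) (n C suc p) (n C p) (n C 1)
      ≡⟨ cong₂ (λ g b → R g b (n C (3 ℕ.+ p)) (n C (2 ℕ.+ p)) (n C suc p) (n C p) (n C 1))
           (trans (cong (_∸ p) (+-split 0 3 p q)) (ℕ.m+n∸m≡n p (3 ℕ.+ q))) (C-split 3 3 p q) ⟩
    R (3 ℕ.+ q) b (n C (3 ℕ.+ p)) (n C (2 ℕ.+ p)) (n C suc p) (n C p) (n C 1)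
      ≡⟨ cong₂ (λ x y → R (3 ℕ.+ q) b x y (n C suc p) (n C p) (n C 1)) (C-split 3 0 p q) (C-split 2 1 p q) ⟩
    R (3 ℕ.+ q) b c₁ c₂ (n C suc p) (n C p) (n C 1)
      ≡⟨ cong₂ (λ x y → R (3 ℕ.+ q) b c₁ c₂ x y (n C 1)) (C-split 1 2 p q) (C-split 0 3 p q) ⟩
    R (3 ℕ.+ q) b c₁ c₂ c₃ c₄ (n C 1)
      ≡⟨ cong (R (3 ℕ.+ q) b c₁ c₂ c₃ c₄) (nC1≡n n) ⟩
    R (3 ℕ.+ q) b c₁ c₂ c₃ c₄ n ∎
    where
    n = 3 ℕ.+ (p ℕ.+ q)
    n+3 = 6 ℕ.+ (p ℕ.+ q)
    b = binom (3 ℕ.+ p) (3 ℕ.+ q)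
    c₁ = binom (3 ℕ.+ p) q
    c₂ = binom (2 ℕ.+ p) (suc q)
    c₃ = binom (suc p) (2 ℕ.+ q)
    c₄ = binom p (3 ℕ.+ q)
    -- `g` stands for n-m, which does not reduce past a truncated subtraction; abstracting it and
    -- the binomial coefficients allows each to be rewritten on its own.
    R : (g b c₁ c₂ c₃ c₄ c₅ : ℕ) → ℤ
    R g b c₁ c₂ c₃ c₄ c₅ = + (suc p ℕ.* (g ∸ 2) ℕ.* b)
      + + n+3 * (+ (suc p ℕ.* c₁ ℕ.+ (2 ℕ.+ p) ℕ.* c₂ ℕ.+ (g ∸ 1) ℕ.* c₃ ℕ.+ (g ∸ 2) ℕ.* c₄) - + (2 ℕ.* c₅))

  rhs-e : ∀ p q → rhs (4 ℕ.+ p) (7 ℕ.+ (p ℕ.+ q)) ≡ + 2 * e (suc p) (suc q)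
  rhs-e p q = begin
    rhs (4 ℕ.+ p) (7 ℕ.+ (p ℕ.+ q))
      ≡⟨ rhs-binom p q ⟩
    + (suc p ℕ.* suc q ℕ.* b) + M * (+ (suc p ℕ.* c₁) + + ((2 ℕ.+ p) ℕ.* c₂) + + ((2 ℕ.+ q) ℕ.* c₃) + + (suc q ℕ.* c₄) - + (2 ℕ.* (3 ℕ.+ (p ℕ.+ q))))
      ≡⟨ cong₂ (λ x y → x + M * y)
           (trans (ℤ.pos-* (suc p ℕ.* suc q) b) (cong (_* + b) (ℤ.pos-* (suc p) (suc q))))
           (cong₂ _-_
             (cong₂ _+_ (cong₂ _+_ (cong₂ _+_ (ℤ.pos-* (suc p) c₁) (ℤ.pos-* (2 ℕ.+ p) c₂)) (ℤ.pos-* (2 ℕ.+ q) c₃)) (ℤ.pos-* (suc q) c₄))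
             (ℤ.pos-* 2 (3 ℕ.+ (p ℕ.+ q)))) ⟩
    + suc p * + suc q * + b + M * (+ suc p * + c₁ + + (2 ℕ.+ p) * + c₂ + + (2 ℕ.+ q) * + c₃ + + suc q * + c₄ - + 2 * + (3 ℕ.+ (p ℕ.+ q)))
      -- Here `b` is expanded by Pascal's rule as c₄ + 3c₃ + 3c₂ + c₁. The stated formula then
      -- differs from `2 * E` by a combination of three brackets, each zero: two instances of
      -- `binom-cross` and one of `binom-absorb₂`.
      ≡⟨ solve 6 (λ p q c₁ c₂ c₃ c₄ →
           let P = k 1 :+ p ; Q = k 1 :+ q ; M = k 6 :+ (p :+ q)
               b = ((c₄ :+ c₃) :+ (c₃ :+ c₂)) :+ ((c₃ :+ c₂) :+ (c₂ :+ c₁)) in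
           P :* Q :* b :+ M :* (P :* c₁ :+ (k 2 :+ p) :* c₂ :+ (k 2 :+ q) :* c₃ :+ Q :* c₄ :- k 2 :* (k 3 :+ (p :+ q)))
           := k 2 :* (P :* Q :* b :+ k 2 :* (P :+ Q :+ k 4) :* (c₃ :+ c₂) :- k 2 :* b :- (P :+ Q :+ k 4) :* (P :+ Q :+ k 1))
              :+ M :* ((k 3 :+ p) :* c₁ :- (k 1 :+ q) :* c₂)
              :- M :* ((k 1 :+ p) :* c₃ :- (k 3 :+ q) :* c₄)
              :- ((k 3 :+ p) :* (k 3 :+ q) :* b :- (k 6 :+ (p :+ q)) :* (k 5 :+ (p :+ q)) :* (c₃ :+ c₂)))
           refl (+ p) (+ q) (+ c₁) (+ c₂) (+ c₃) (+ c₄) ⟩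
    + 2 * E + M * (+ (3 ℕ.+ p) * + c₁ - + suc q * + c₂) - M * (+ suc p * + c₃ - + (3 ℕ.+ q) * + c₄)
      - (+ (3 ℕ.+ p) * + (3 ℕ.+ q) * + b - + (6 ℕ.+ (p ℕ.+ q)) * + (5 ℕ.+ (p ℕ.+ q)) * + (c₃ ℕ.+ c₂))
      ≡⟨ cong₂ (λ x y → + 2 * E + M * x - M * y
             - (+ (3 ℕ.+ p) * + (3 ℕ.+ q) * + b - + (6 ℕ.+ (p ℕ.+ q)) * + (5 ℕ.+ (p ℕ.+ q)) * + (c₃ ℕ.+ c₂)))
           (ℤ.i≡j⇒i-j≡0 (pos-*-cong (3 ℕ.+ p) c₁ (suc q) c₂ (binom-cross (2 ℕ.+ p) q)))
           (ℤ.i≡j⇒i-j≡0 (pos-*-cong (suc p) c₃ (3 ℕ.+ q) c₄ (binom-cross p (2 ℕ.+ q)))) ⟩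
    + 2 * E + M * + 0 - M * + 0
      - (+ (3 ℕ.+ p) * + (3 ℕ.+ q) * + b - + (6 ℕ.+ (p ℕ.+ q)) * + (5 ℕ.+ (p ℕ.+ q)) * + (c₃ ℕ.+ c₂))
      ≡⟨ cong (λ x → + 2 * E + M * + 0 - M * + 0 - x) (ℤ.i≡j⇒i-j≡0 absorb) ⟩
    + 2 * E + M * + 0 - M * + 0 - + 0
      ≡⟨ solve 2 (λ E M → k 2 :* E :+ M :* k 0 :- M :* k 0 :- k 0 := k 2 :* E) refl E M ⟩
    + 2 * E ∎
    where
    open ℤ-Solver
    k : ∀ {m} → ℕ → Polynomial m
    k i = con (+ i)
    E = e (suc p) (suc q)
    M = + (6 ℕ.+ (p ℕ.+ q))
    b = binom (3 ℕ.+ p) (3 ℕ.+ q)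
    c₁ = binom (3 ℕ.+ p) q
    c₂ = binom (2 ℕ.+ p) (suc q)
    c₃ = binom (suc p) (2 ℕ.+ q)
    c₄ = binom p (3 ℕ.+ q)
    absorb : + (3 ℕ.+ p) * + (3 ℕ.+ q) * + b ≡ + (6 ℕ.+ (p ℕ.+ q)) * + (5 ℕ.+ (p ℕ.+ q)) * + (c₃ ℕ.+ c₂)
    absorb = begin
      + (3 ℕ.+ p) * + (3 ℕ.+ q) * + b
        ≡⟨ cong (_* + b) (sym (ℤ.pos-* (3 ℕ.+ p) (3 ℕ.+ q))) ⟩
      + ((3 ℕ.+ p) ℕ.* (3 ℕ.+ q)) * + b
        ≡⟨ pos-*-cong ((3 ℕ.+ p) ℕ.* (3 ℕ.+ q)) b ((6 ℕ.+ (p ℕ.+ q)) ℕ.* (5 ℕ.+ (p ℕ.+ q))) (c₃ ℕ.+ c₂) (trans (binom-absorb₂ (2 ℕ.+ p) (2 ℕ.+ q))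
             (cong (λ m → (2 ℕ.+ m) ℕ.* suc m ℕ.* (c₃ ℕ.+ c₂))
               (cong (2 ℕ.+_) (trans (ℕ.+-suc p (suc q)) (cong suc (ℕ.+-suc p q)))))) ⟩
      + ((6 ℕ.+ (p ℕ.+ q)) ℕ.* (5 ℕ.+ (p ℕ.+ q))) * + (c₃ ℕ.+ c₂)
        ≡⟨ cong (_* + (c₃ ℕ.+ c₂)) (ℤ.pos-* (6 ℕ.+ (p ℕ.+ q)) (5 ℕ.+ (p ℕ.+ q))) ⟩
      + (6 ℕ.+ (p ℕ.+ q)) * + (5 ℕ.+ (p ℕ.+ q)) * + (c₃ ℕ.+ c₂) ∎

  -- Strict growth towards the centre

  binom-pos : ∀ p q → 0 < binom p q
  binom-pos zero    q       = s≤s z≤n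
  binom-pos (suc p) zero    = s≤s z≤n
  binom-pos (suc p) (suc q) = ℕ.≤-trans (binom-pos p (suc q)) (ℕ.m≤m+n _ _)

  -- By `binom-cross` the larger and the smaller coefficient are in the ratio q+1 to p+1; positivity
  -- makes the inequality strict.
  binom-increasing : ∀ p q → p < q → binom p (suc q) < binom (suc p) q
  binom-increasing p q p<q = ℕ.≰⇒> λ ≤ → ℕ.<-irrefl (binom-cross p q)
    (ℕ.≤-<-trans (ℕ.*-monoʳ-≤ (suc p) ≤)
      (ℕ.*-monoˡ-< (binom p (suc q)) {{ℕ.>-nonZero (binom-pos p (suc q))}} (s≤s p<q)))

  -- A form suited to comparison: the negative multiple of the first binomial coefficient is
  -- absorbed into `c`, that is PQ-2, and what is still subtracted depends on P+Q alone. Two words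
  -- of the same length can thus be compared within the natural numbers.
  e-ℕ : ∀ P Q c M → P ℕ.* Q ≡ 2 ℕ.+ c → 3 ℕ.+ M ≡ P ℕ.+ Q ℕ.+ 4 →
    e P Q ≡ + (c ℕ.* binom (2 ℕ.+ P) (2 ℕ.+ Q) ℕ.+ 2 ℕ.* (3 ℕ.+ M) ℕ.* binom (suc P) (suc Q)) - + ((3 ℕ.+ M) ℕ.* M)
  e-ℕ P Q c M PQ M≡ = begin
    + P * + Q * + x + + 2 * + (P ℕ.+ Q ℕ.+ 4) * + y - + 2 * + x - + (P ℕ.+ Q ℕ.+ 4) * + (P ℕ.+ Q ℕ.+ 1)
      ≡⟨ cong₂ (λ a b → a * + x + + 2 * + b * + y - + 2 * + x - + b * + (P ℕ.+ Q ℕ.+ 1))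
           (trans (sym (ℤ.pos-* P Q)) (cong +_ PQ)) (sym M≡) ⟩
    (+ 2 + + c) * + x + + 2 * (+ 3 + + M) * + y - + 2 * + x - (+ 3 + + M) * + (P ℕ.+ Q ℕ.+ 1)
      ≡⟨ cong (λ m → (+ 2 + + c) * + x + + 2 * (+ 3 + + M) * + y - + 2 * + x - (+ 3 + + M) * + m) (sym M≡′) ⟩
    (+ 2 + + c) * + x + + 2 * (+ 3 + + M) * + y - + 2 * + x - (+ 3 + + M) * + M
      ≡⟨ solve 4 (λ c x y M → (con (+ 2) :+ c) :* x :+ con (+ 2) :* (con (+ 3) :+ M) :* y :- con (+ 2) :* x :- (con (+ 3) :+ M) :* M
           := c :* x :+ con (+ 2) :* (con (+ 3) :+ M) :* y :- (con (+ 3) :+ M) :* M) refl (+ c) (+ x) (+ y) (+ M) ⟩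
    + c * + x + + 2 * + (3 ℕ.+ M) * + y - + (3 ℕ.+ M) * + M
      ≡⟨ cong₂ _-_ (cong₂ _+_ (sym (ℤ.pos-* c x))
           (sym (trans (ℤ.pos-* (2 ℕ.* (3 ℕ.+ M)) y) (cong (_* + y) (ℤ.pos-* 2 (3 ℕ.+ M))))))
           (sym (ℤ.pos-* (3 ℕ.+ M) M)) ⟩
    + (c ℕ.* x ℕ.+ 2 ℕ.* (3 ℕ.+ M) ℕ.* y) - + ((3 ℕ.+ M) ℕ.* M) ∎
    where
    open ℤ-Solver
    x = binom (2 ℕ.+ P) (2 ℕ.+ Q)
    y = binom (suc P) (suc Q)
    M≡′ : M ≡ P ℕ.+ Q ℕ.+ 1
    M≡′ = ℕ.+-cancelˡ-≡ 3 M _ (trans M≡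
      (ℕ-Solver.solve 1 (λ s → s ℕ-Solver.:+ ℕ-Solver.con 4 ℕ-Solver.:= ℕ-Solver.con 3 ℕ-Solver.:+ (s ℕ-Solver.:+ ℕ-Solver.con 1)) refl (P ℕ.+ Q)))

  -- Moving the middle peak towards the centre increases both binomial
  -- coefficients and does not decrease the product of the two gaps.
  e-increasing : ∀ p r → let P = suc p ; Q = 2 ℕ.+ (p ℕ.+ r) in e P (suc Q) ℤ.< e (suc P) Q
  e-increasing p r = subst₂ ℤ._<_
    (sym (e-ℕ P (suc Q) c M (sym (ℕ.m+[n∸m]≡n 2≤PQ)) M≡))
    (sym (e-ℕ (suc P) Q c′ M (sym (ℕ.m+[n∸m]≡n (ℕ.≤-trans 2≤PQ PQ≤))) (trans M≡ (cong (ℕ._+ 4) (ℕ.+-suc P Q)))))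
    (ℤ.+-monoˡ-< (- + ((3 ℕ.+ M) ℕ.* M)) (ℤ.+<+ (ℕ.+-mono-≤-<
      (ℕ.*-mono-≤ (ℕ.∸-monoˡ-≤ 2 PQ≤) (ℕ.<⇒≤ (binom-increasing (2 ℕ.+ P) (2 ℕ.+ Q) (s≤s (s≤s P<Q)))))
      (ℕ.*-monoʳ-< (2 ℕ.* (3 ℕ.+ M)) (binom-increasing (suc P) (suc Q) (s≤s P<Q))))))
    where
    P = suc p
    Q = 2 ℕ.+ (p ℕ.+ r)
    c = P ℕ.* suc Q ∸ 2
    c′ = suc P ℕ.* Q ∸ 2
    M = P ℕ.+ suc Q ℕ.+ 1
    P<Q : P < Q
    P<Q = s≤s (s≤s (ℕ.m≤m+n p r))
    2≤PQ : 2 ≤ P ℕ.* suc Q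
    2≤PQ = ℕ.≤-trans (s≤s (s≤s z≤n)) (ℕ.m≤m+n (suc Q) (p ℕ.* suc Q))
    PQ≤ : P ℕ.* suc Q ≤ suc P ℕ.* Q
    PQ≤ = subst (_≤ Q ℕ.+ P ℕ.* Q) (sym (ℕ.*-suc P Q)) (ℕ.+-monoˡ-≤ (P ℕ.* Q) (ℕ.<⇒≤ P<Q))
    M≡ : 3 ℕ.+ M ≡ P ℕ.+ suc Q ℕ.+ 4
    M≡ = solve 1 (λ s → con 3 :+ (s :+ con 1) := s :+ con 4) refl (P ℕ.+ suc Q)
      where open ℕ-Solver

  -- Formula, symmetry and single steps for `#P`

  gaps : ∀ {m n} → 4 ≤ m → m ℕ.+ 3 ≤ n → ∃₂ λ p q → m ≡ 4 ℕ.+ p × n ≡ 7 ℕ.+ (p ℕ.+ q)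
  gaps {m} {n} 4≤m m+3≤n = m ∸ 4 , n ∸ (m ℕ.+ 3) , m≡ , (begin
    n                                        ≡⟨ sym (ℕ.m+[n∸m]≡n m+3≤n) ⟩
    m ℕ.+ 3 ℕ.+ q                            ≡⟨ cong (λ m → m ℕ.+ 3 ℕ.+ q) m≡ ⟩
    4 ℕ.+ (m ∸ 4) ℕ.+ 3 ℕ.+ q                ≡⟨ solve 2 (λ p q → con 4 :+ p :+ con 3 :+ q := con 7 :+ (p :+ q)) refl (m ∸ 4) q ⟩
    7 ℕ.+ (m ∸ 4 ℕ.+ q)                      ∎)
    where
    open ℕ-Solver
    q = n ∸ (m ℕ.+ 3)
    m≡ : m ≡ 4 ℕ.+ (m ∸ 4)
    m≡ = sym (ℕ.m+[n∸m]≡n 4≤m)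

  below-half : ∀ {m n} → 4 ≤ m → m ℕ.+ m < n → m ℕ.+ 3 ≤ n
  below-half {m} 4≤m 2m<n = ℕ.≤-trans (ℕ.+-monoʳ-≤ m (ℕ.≤-trans (ℕ.n≤1+n 3) 4≤m)) (ℕ.<⇒≤ 2m<n)

  #P-formula : ∀ m n → 4 ≤ m → m ℕ.+ 3 ≤ n → + 2 * + #P S[2, m , n -1] n ≡ rhs m n * + (2 ^ (n ∸ 4))
  #P-formula m n 4≤m m+3≤n with p , q , refl , refl ← gaps 4≤m m+3≤n = begin
    + 2 * + #P S[2, m , n -1] n           ≡⟨ cong (+ 2 *_) (count m n p q refl refl) ⟩
    + 2 * (+ (2 ^ (n ∸ 4)) * E)           ≡⟨ solve 2 (λ x E → con (+ 2) :* (x :* E) := con (+ 2) :* E :* x) refl (+ (2 ^ (n ∸ 4))) E ⟩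
    + 2 * E * + (2 ^ (n ∸ 4))             ≡⟨ cong (_* + (2 ^ (n ∸ 4))) (sym (rhs-e p q)) ⟩
    rhs m n * + (2 ^ (n ∸ 4))             ∎
    where
    open ℤ-Solver
    E = e (suc p) (suc q)

  #P-symmetric : ∀ m n → 4 ≤ m → m ℕ.+ 3 ≤ n → #P S[2, m , n -1] n ≡ #P S[2, n ℕ.+ 1 ∸ m , n -1] n
  #P-symmetric m n 4≤m m+3≤n with p , q , refl , refl ← gaps 4≤m m+3≤n = ℤ.+-injective (begin
    + #P S[2, m , n -1] n                       ≡⟨ count m n p q refl refl ⟩
    + (2 ^ (n ∸ 4)) * e (suc p) (suc q)         ≡⟨ cong (+ (2 ^ (n ∸ 4)) *_) (e-sym (suc p) (suc q)) ⟩
    + (2 ^ (n ∸ 4)) * e (suc q) (suc p)         ≡⟨ sym (count (n ℕ.+ 1 ∸ m) n q p mirror (cong (7 ℕ.+_) (ℕ.+-comm p q))) ⟩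
    + #P S[2, n ℕ.+ 1 ∸ m , n -1] n             ∎)
    where
    open ℕ-Solver
    mirror : 7 ℕ.+ (p ℕ.+ q) ℕ.+ 1 ∸ (4 ℕ.+ p) ≡ 4 ℕ.+ q
    mirror = trans (cong (_∸ (4 ℕ.+ p)) (solve 2 (λ p q → con 7 :+ (p :+ q) :+ con 1 := con 4 :+ p :+ (con 4 :+ q)) refl p q))
                   (ℕ.m+n∸m≡n (4 ℕ.+ p) (4 ℕ.+ q))

  -- The hypothesis 2m < n says that `suc m` is at most (n+1)/2, so the step does not pass the
  -- centre. For 2m = n the two indices are mirror images and the values agree.
  #P-step : ∀ m n → 4 ≤ m → m ℕ.+ m < n → #P S[2, m , n -1] n < #P S[2, suc m , n -1] n
  #P-step m n 4≤m 2m<n with p , q , refl , refl ← gaps {m} {n} 4≤m (below-half 4≤m 2m<n) = ℤ.drop‿+<+ (subst₂ ℤ._<_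
    (sym (count m n p (2 ℕ.+ (p ℕ.+ r)) refl (cong (λ q → 7 ℕ.+ (p ℕ.+ q)) q≡)))
    (sym (count (suc m) n (suc p) (suc (p ℕ.+ r)) refl
      (cong (7 ℕ.+_) (trans (cong (p ℕ.+_) q≡) (ℕ.+-suc p (suc (p ℕ.+ r)))))))
    (ℤ.*-monoˡ-<-pos (+ (2 ^ (n ∸ 4))) {{positive}} (e-increasing p r)))
    where
    2+p≤q : 2 ℕ.+ p ≤ q
    2+p≤q = ℕ.+-cancelˡ-≤ (7 ℕ.+ p) _ _ (subst (_≤ 7 ℕ.+ (p ℕ.+ q))
      (solve 1 (λ p → con 1 :+ (con 4 :+ p :+ (con 4 :+ p)) := con 7 :+ p :+ (con 2 :+ p)) refl p) 2m<n)
      where open ℕ-Solver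
    r = q ∸ (2 ℕ.+ p)
    q≡ : q ≡ 2 ℕ.+ (p ℕ.+ r)
    q≡ = sym (ℕ.m+[n∸m]≡n 2+p≤q)
    positive : ℤ.Positive (+ (2 ^ (n ∸ 4)))
    positive = ℤ.positive (ℤ.+<+ (ℕ.m^n>0 2 (n ∸ 4)))

open import Data.Nat using (_+_; _*_; _≟_)
open import Data.Integer using (ℤ; +_) renaming (_*_ to _*ℤ_)
open ClosedForm using (#P-formula; #P-symmetric; #P-step)

-- Unimodality and the location of the maximum

v : ℕ → ℕ → ℕ
v n m = #P S[2, m , n -1] n

-- A chain of single steps that ends no later than the centre. Its strictness is what confines the
-- maximum to the middle indices.
rising : ∀ n {i j} → 4 ≤ i → i < j → j + j ≤ suc n → v n i < v n j
rising n {i} {suc j} 4≤i (s≤s i≤j) 2j≤ with ℕₚ.m≤n⇒m<n∨m≡n i≤j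
... | inj₂ refl = #P-step i n 4≤i (double-pred i 2j≤)
  where
  double-pred : ∀ j → suc j + suc j ≤ suc n → j + j < n
  double-pred j (s≤s le) = subst (_≤ n) (ℕₚ.+-suc j j) le
... | inj₁ i<j  = ℕₚ.<-trans (rising n 4≤i i<j (ℕₚ.≤-trans (ℕₚ.n≤1+n _) (ℕₚ.≤-trans (ℕₚ.n≤1+n _) le)))
                             (#P-step j n (ℕₚ.≤-trans 4≤i i≤j) (ℕₚ.≤-pred le))
  where
  le : suc (suc (j + j)) ≤ suc n
  le = subst (_≤ suc n) (cong suc (ℕₚ.+-suc j j)) 2j≤

module Unimodal (n : ℕ) (7≤n : 7 ≤ n) where

  k k′ : ℕ
  k  = ⌊ n + 1 /2⌋
  k′ = ⌈ n + 1 /2⌉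

  n+1≡ : n + 1 ≡ suc n
  n+1≡ = ℕₚ.+-comm n 1

  4≤k : 4 ≤ k
  4≤k = ℕₚ.⌊n/2⌋-mono (ℕₚ.+-monoˡ-≤ 1 7≤n)

  2k≤ : k + k ≤ suc n
  2k≤ = subst (k + k ≤_) (trans (ℕₚ.⌊n/2⌋+⌈n/2⌉≡n (n + 1)) n+1≡) (ℕₚ.+-monoʳ-≤ k (ℕₚ.⌊n/2⌋≤⌈n/2⌉ (n + 1)))

  k+3≤n : k + 3 ≤ n
  k+3≤n = ℕₚ.≤-pred (subst (_≤ suc n) (ℕₚ.+-suc k 3) (ℕₚ.≤-trans (ℕₚ.+-monoʳ-≤ k 4≤k) 2k≤))

  k′≤1+k : k′ ≤ suc k
  -- `⌈_/2⌉` unfolds to the floor half of the successor, and `suc k` is the floor half of the second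
  -- successor.
  k′≤1+k = ℕₚ.⌊n/2⌋-mono (ℕₚ.n≤1+n (suc (n + 1)))

  mirror-k : n + 1 ∸ k ≡ k′
  mirror-k = trans (cong (_∸ k) (sym (ℕₚ.⌊n/2⌋+⌈n/2⌉≡n (n + 1)))) (ℕₚ.m+n∸m≡n k k′)

  mirror-k′ : n + 1 ∸ k′ ≡ k
  mirror-k′ = trans (cong (_∸ k′) (sym (ℕₚ.⌊n/2⌋+⌈n/2⌉≡n (n + 1)))) (ℕₚ.m+n∸n≡m k k′)

  mirror-≥4 : ∀ {m} → m + 3 ≤ n → 4 ≤ n + 1 ∸ m
  mirror-≥4 {m} m+3≤n = subst (_≤ n + 1 ∸ m) (ℕₚ.m+n∸m≡n m 4)
    (ℕₚ.∸-monoˡ-≤ m (subst (_≤ n + 1) (ℕₚ.+-assoc m 3 1) (ℕₚ.+-monoˡ-≤ 1 m+3≤n)))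

  increasing : ∀ i j → 4 ≤ i → i ≤ j → j ≤ k → v n i ≤ v n j
  increasing i j 4≤i i≤j j≤k with ℕₚ.m≤n⇒m<n∨m≡n i≤j
  ... | inj₁ i<j  = ℕₚ.<⇒≤ (rising n 4≤i i<j (ℕₚ.≤-trans (ℕₚ.+-mono-≤ j≤k j≤k) 2k≤))
  ... | inj₂ refl = ℕₚ.≤-refl

  -- To the left of the centre this is `rising`. To the right, `m` lies beyond both middle indices,
  -- which differ by at most 1, so its mirror image lies strictly below `k`.
  below-max : ∀ m → 4 ≤ m → m + 3 ≤ n → m ≢ k → m ≢ k′ → v n m < v n k
  below-max m 4≤m m+3≤n m≢k m≢k′ with ℕₚ.≤-total m k
  ... | inj₁ m≤k = rising n 4≤m (ℕₚ.≤∧≢⇒< m≤k m≢k) 2k≤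
  ... | inj₂ k≤m = subst (_< v n k) (sym (#P-symmetric m n 4≤m m+3≤n))
    (rising n (mirror-≥4 m+3≤n) (subst (n + 1 ∸ m <_) mirror-k′ (ℕₚ.∸-monoʳ-< k′<m m≤n+1)) 2k≤)
    where
    k′<m : k′ < m
    k′<m = ℕₚ.≤∧≢⇒< (ℕₚ.≤-trans k′≤1+k (ℕₚ.≤∧≢⇒< k≤m (≢-sym m≢k))) (≢-sym m≢k′)
    m≤n+1 : m ≤ n + 1
    m≤n+1 = ℕₚ.≤-trans (ℕₚ.m≤m+n m 3) (ℕₚ.≤-trans m+3≤n (ℕₚ.m≤m+n n 1))

  v-k′ : v n k′ ≡ v n k
  v-k′ = sym (trans (#P-symmetric k n 4≤k k+3≤n) (cong (v n) mirror-k))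

  max : ∀ m → 4 ≤ m → m + 3 ≤ n → v n m ≤ v n k
  max m 4≤m m+3≤n with m ≟ k | m ≟ k′
  ... | yes refl | _        = ℕₚ.≤-refl
  ... | no _     | yes refl = ℕₚ.≤-reflexive v-k′
  ... | no m≢k   | no m≢k′  = ℕₚ.<⇒≤ (below-max m 4≤m m+3≤n m≢k m≢k′)

  decreasing : ∀ i j → k ≤ i → i ≤ j → j + 3 ≤ n → v n j ≤ v n i
  decreasing i j k≤i i≤j j+3≤n with ℕₚ.m≤n⇒m<n∨m≡n k≤i
  -- The index `k` is treated apart: its mirror image `k′` may exceed `k` and so leave the range of
  -- `increasing`. Every larger `i` is at least `k′` and is reflected to an index at most `k`.
  ... | inj₂ refl = max j (ℕₚ.≤-trans 4≤k i≤j) j+3≤n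
  ... | inj₁ k<i  = subst₂ _≤_
    (sym (#P-symmetric j n (ℕₚ.≤-trans 4≤i i≤j) j+3≤n))
    (sym (#P-symmetric i n 4≤i (ℕₚ.≤-trans (ℕₚ.+-monoˡ-≤ 3 i≤j) j+3≤n)))
    (increasing (n + 1 ∸ j) (n + 1 ∸ i) (mirror-≥4 j+3≤n) (ℕₚ.∸-monoʳ-≤ (n + 1) i≤j)
      (subst (n + 1 ∸ i ≤_) mirror-k′ (ℕₚ.∸-monoʳ-≤ (n + 1) (ℕₚ.≤-trans k′≤1+k k<i))))
    where
    4≤i : 4 ≤ i
    4≤i = ℕₚ.≤-trans 4≤k k≤i

  attained : ∀ m → m ≡ k ⊎ m ≡ k′ → ∀ m′ → 4 ≤ m′ → m′ + 3 ≤ n → v n m′ ≤ v n m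
  attained m (inj₁ refl) m′ 4≤m′ m′+3≤n = max m′ 4≤m′ m′+3≤n
  attained m (inj₂ refl) m′ 4≤m′ m′+3≤n = subst (v n m′ ≤_) (sym v-k′) (max m′ 4≤m′ m′+3≤n)

theorem4p3 : ((m n : ℕ) → 4 ≤ m → m + 3 ≤ n →
    (+ 2) *ℤ (+ #P S[2, m , n -1] n) ≡ rhs m n *ℤ (+ (2 ^ (n ∸ 4))))
    × ((n : ℕ) → 7 ≤ n →
    ((m : ℕ) → 4 ≤ m → m + 3 ≤ n →
    #P S[2, m , n -1] n ≡ #P S[2, n + 1 ∸ m , n -1] n)
    × (∃ λ k → 4 ≤ k × k + 3 ≤ n
    × ((i j : ℕ) → 4 ≤ i → i ≤ j → j ≤ k →
    #P S[2, i , n -1] n ≤ #P S[2, j , n -1] n)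
    × ((i j : ℕ) → k ≤ i → i ≤ j → j + 3 ≤ n →
    #P S[2, j , n -1] n ≤ #P S[2, i , n -1] n))
    × ((m : ℕ) → 4 ≤ m → m + 3 ≤ n →
    ((m ≡ ⌊ n + 1 /2⌋ ⊎ m ≡ ⌈ n + 1 /2⌉) →
    (m′ : ℕ) → 4 ≤ m′ → m′ + 3 ≤ n →
    #P S[2, m′ , n -1] n ≤ #P S[2, m , n -1] n)
    × ((m ≢ ⌊ n + 1 /2⌋ × m ≢ ⌈ n + 1 /2⌉) →
    #P S[2, m , n -1] n < #P S[2, ⌊ n + 1 /2⌋ , n -1] n)))
theorem4p3 = #P-formula , λ n 7≤n → let open Unimodal n 7≤n in
    (λ m → #P-symmetric m n)
  , (k , 4≤k , k+3≤n , increasing , decreasing)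
  , (λ m 4≤m m+3≤n → attained m , λ (m≢k , m≢k′) → below-max m 4≤m m+3≤n m≢k m≢k′)
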